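{- Let $k \ge \ell \ge 2$ be integers. Let $\varepsilon \in \left(0,\frac{1}{4k}\right)$. Let $G$ be a graph with $d=\mathrm{d}(G) \ge 1/\varepsilon$. Then $G$ contains at least one of the following: (i) a subgraph $H$ with $|V(H)|\le 3k^3d$ and $|E(H)|\ge \varepsilon^2d^2/2$, or (ii) a bipartite subgraph $H=(X,Y)$ with $|X| > \ell |Y|$ such that every vertex in $X$ has at least $(1-2k\varepsilon)d$ neighbors in $Y$, or (iii) a $k$-bounded minor $G'$ with $\mathrm{d}(G') \ge \frac{k}{8\ell} (1-2k\varepsilon) d$.
   Context: All graphs are finite and simple. $\mathrm{d}(G)=|E(G)|/|V(G)|$ denotes density. A $k$-bounded minor of $G$ is a minor having a model in $G$ in which every branch set has at most $k$ vertices (i.e. obtained from a subgraph by contracting connected subgraphs on at most $k$ vertices).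
   Formalization: ε is taken rational instead of real; and in (ii) the formal condition only forbids edges inside X, so the bipartite subgraph is obtained after deleting any edges of H inside Y, which does not change the neighbour counts. -}

module Defs where

open import Data.Bool using (Bool; true; false; if_then_else_; _∧_)
open import Data.Nat as ℕ using (ℕ; zero; suc; _<ᵇ_; NonZero)
open import Data.Fin using (Fin; toℕ) renaming (zero to fzero; suc to fsuc)
open import Data.Integer using (+_)
open import Data.Rational using (ℚ; 0ℚ; _<_; _/_; 1/_; positive)
open import Data.Rational.Properties using (pos⇒nonZero)
open import Data.Product using (Σ; ∃; _×_; _,_)
open import Data.Empty using (⊥)
open import Function using (_∘_; Injective)
open import Relation.Binary.PropositionalEquality using (_≡_; _≢_)

record Graph : Set where
  field
    n     : ℕ
    adj   : Fin n → Fin n → Bool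
    sym   : ∀ u v → adj u v ≡ adj v u
    irref : ∀ v → adj v v ≡ false
open Graph public

countF : ∀ {n} → (Fin n → Bool) → ℕ
countF {zero}  p = 0
countF {suc n} p = (if p fzero then 1 else 0) ℕ.+ countF (p ∘ fsuc)

sumF : ∀ {n} → (Fin n → ℕ) → ℕ
sumF {zero}  f = 0
sumF {suc n} f = f fzero ℕ.+ sumF (f ∘ fsuc)

edges : Graph → ℕ
edges G = sumF (λ i → countF (λ j → (toℕ i <ᵇ toℕ j) ∧ adj G i j))

⟦_⟧ : ℕ → ℚ
⟦ m ⟧ = (+ m) / 1

density : (G : Graph) → .{{NonZero (n G)}} → ℚ
density G = (+ edges G) / n G

-- 1/b for a natural b (junk value 0 for b = 0; only used with b ≥ 1)
recip : ℕ → ℚ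
recip zero    = 0ℚ
recip (suc b) = (+ 1) / suc b

inv : (ε : ℚ) → 0ℚ < ε → ℚ
inv ε ε>0 = (1/ ε) {{pos⇒nonZero ε {{positive ε>0}}}}

record SubgraphOf (H G : Graph) : Set where
  field
    emb     : Fin (n H) → Fin (n G)
    inj     : Injective _≡_ _≡_ emb
    presAdj : ∀ u v → adj H u v ≡ true → adj G (emb u) (emb v) ≡ true
open SubgraphOf public

data WalkIn (G : Graph) (S : Fin (n G) → Bool) : Fin (n G) → Fin (n G) → Set where
  here : ∀ {u} → S u ≡ true → WalkIn G S u u
  step : ∀ {u w v} → S u ≡ true → adj G u w ≡ true → WalkIn G S w v → WalkIn G S u v

Connected : (G : Graph) → (Fin (n G) → Bool) → Set
Connected G S = ∀ u v → S u ≡ true → S v ≡ true → WalkIn G S u v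

record BoundedMinorModel (k : ℕ) (M G : Graph) : Set where
  field
    branch    : Fin (n M) → Fin (n G) → Bool
    nonempty  : ∀ a → ∃ λ v → branch a v ≡ true
    disjoint  : ∀ a b v → a ≢ b → branch a v ≡ true → branch b v ≡ true → ⊥
    connected : ∀ a → Connected G (branch a)
    small     : ∀ a → countF (branch a) ℕ.≤ k
    realise   : ∀ a b → adj M a b ≡ true →
                ∃ λ u → ∃ λ v → branch a u ≡ true × branch b v ≡ true × adj G u v ≡ true
open BoundedMinorModel public

BoundedMinor : ℕ → Graph → Graph → Set
BoundedMinor k M G = BoundedMinorModel k M G

{-# OPTIONS --safe #-}
module Submission where

-- Pass to a subgraph of minimum degree d and suppose that (i) and (ii) fail. Contract edges greedily, as
-- long as a contraction destroys few edges: by sparseness (the failure of (i)), for every small connected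
-- class without big vertices all but about εd edges at each of its vertices are cheap to contract. First
-- build classes of between k/(2ℓ+2) and k/(ℓ+1) vertices. Vertices left over in smaller classes (the set X)
-- have nearly all neighbours in the large classes, and are attached to these one by one, in order of
-- decreasing degree, until a class has k vertices. The vertices that cannot be attached have nearly all
-- neighbours in the full classes, so by the failure of (ii) there are never more of them than attached
-- ones; hence deleting them costs at most half of the edges. The result has at most 4ℓe/(kd) vertices
-- and about e/2 edges, where e is the number of edges of the subgraph.

open import Defs hiding (sym)
open import Data.Bool using (Bool; true; false; _∧_; _∨_; _xor_; not; if_then_else_)
import Data.Bool.Properties as Bool
open import Data.Nat as ℕ using (ℕ; zero; suc; NonZero)
open import Data.Nat.Tactic.RingSolver using (solve-∀)
open import Data.Fin using (Fin; toℕ) renaming (zero to fzero; suc to fsuc)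
import Data.Fin.Properties as F
open import Data.Product using (Σ; ∃; _×_; _,_; proj₁; proj₂)
open import Data.Sum using (_⊎_; inj₁; inj₂)
open import Data.Empty using (⊥; ⊥-elim)
open import Function using (_∘_)
open import Relation.Nullary using (¬_; Dec; yes; no)
open import Relation.Binary.PropositionalEquality hiding ([_])

-- The failure of (ii) bounds only the number of the vertices that cannot be attached, whereas the
-- edges lost by deleting them are governed by their degrees. The order of decreasing degree closes
-- this gap: numbers compared at every degree threshold δ give, by summation by parts, a comparison
-- of degree sums. The factor ℓ + 1 in the size of the first classes is dictated by (ii): at most
-- k/(ℓ+1) of the k vertices of a full class are old ones, so there are at least ℓ attached vertices
-- for each old one. A vertex is big if its degree exceeds kd. The classes adjacent to its class may
-- be too many to fit into a set of 3k³d vertices, so (i) gives no control over it. But there are at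
-- most 2e/(kd) big vertices, and each may be a class of its own. The other classes number at most
-- 2(ℓ+1)/k times the number of vertices, hence at most 2(ℓ+1)e/(kd). The sum (2ℓ+4)e/(kd) is at
-- most 4ℓe/(kd) because ℓ ≥ 2.

module Combinatorics where

  open import Data.Fin.Subset using (Subset)
  open import Data.Fin.Subset.Properties using (anySubset?)
  open import Data.Nat
  open import Data.Nat.DivMod
  open import Data.Nat.Properties
  open import Algebra.Properties.CommutativeSemigroup +-commutativeSemigroup using ()
    renaming (interchange to +-interchange)
  open import Data.Vec using (lookup; tabulate)
  open import Data.Vec.Properties using (lookup∘tabulate)
  open import Relation.Binary.Definitions using (tri<; tri≈; tri>)
  open import Relation.Nullary.Decidable using (⌊_⌋; _×-dec_; _→-dec_)

  -- Finite sums and counting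

  ι : Bool → ℕ
  ι b = if b then 1 else 0

  _==_ : ∀ {n} → Fin n → Fin n → Bool
  x == y = ⌊ x F.≟ y ⌋

  ==-refl : ∀ {n} (x : Fin n) → (x == x) ≡ true
  ==-refl x with x F.≟ x
  ... | yes _ = refl
  ... | no ¬p = ⊥-elim (¬p refl)

  ==⇒≡ : ∀ {n} {x y : Fin n} → (x == y) ≡ true → x ≡ y
  ==⇒≡ {x = x} {y} e with x F.≟ y
  ... | yes p = p
  ==⇒≡ () | no _

  ≢⇒== : ∀ {n} {x y : Fin n} → x ≢ y → (x == y) ≡ false
  ≢⇒== {x = x} {y} ne with x F.≟ y
  ... | yes p = ⊥-elim (ne p)
  ... | no _ = refl

  ==⇒≢ : ∀ {n} {x y : Fin n} → (x == y) ≡ false → x ≢ y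
  ==⇒≢ {x = x} e refl with trans (sym e) (==-refl x)
  ... | ()

  ==-sym : ∀ {n} (x y : Fin n) → (x == y) ≡ (y == x)
  ==-sym x y with x F.≟ y
  ... | yes refl = sym (==-refl x)
  ... | no ne = sym (≢⇒== (ne ∘ sym))

  true≢false : ∀ {b} → b ≡ true → b ≡ false → ⊥
  true≢false refl ()

  ∧-intro : ∀ {a b} → a ≡ true → b ≡ true → a ∧ b ≡ true
  ∧-intro refl refl = refl

  ∧-fst : ∀ {a b} → a ∧ b ≡ true → a ≡ true
  ∧-fst {true} _ = refl

  ∧-snd : ∀ {a b} → a ∧ b ≡ true → b ≡ true
  ∧-snd {true} e = e

  not-true : ∀ {a} → not a ≡ true → a ≡ false
  not-true {false} _ = refl

  not-false : ∀ {a} → a ≡ false → not a ≡ true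
  not-false refl = refl

  ι-true : ∀ {b} → b ≡ true → ι b ≡ 1
  ι-true refl = refl

  ι-false : ∀ {b} → b ≡ false → ι b ≡ 0
  ι-false refl = refl

  ι≤1 : ∀ b → ι b ≤ 1
  ι≤1 true = ≤-refl
  ι≤1 false = z≤n

  ι-mono : ∀ {a b} → (a ≡ true → b ≡ true) → ι a ≤ ι b
  ι-mono {false} _ = z≤n
  ι-mono {true} f = ≤-reflexive (sym (ι-true (f refl)))

  ι-∧ : ∀ a b → ι (a ∧ b) ≡ ι a * ι b
  ι-∧ true b = sym (+-identityʳ _)
  ι-∧ false b = refl

  ι*-≤ : ∀ {x y} b → (b ≡ true → x ≤ y) → ι b * x ≤ ι b * y
  ι*-≤ true f = +-monoˡ-≤ 0 (f refl)
  ι*-≤ false f = z≤n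

  ι*-≤-self : ∀ b x → ι b * x ≤ x
  ι*-≤-self true x = ≤-reflexive (+-identityʳ x)
  ι*-≤-self false x = z≤n

  ι*-bound : ∀ {x y} b → (b ≡ true → x ≤ y) → ι b * x ≤ y
  ι*-bound {x} {y} b f = ≤-trans (ι*-≤ b f) (ι*-≤-self b y)

  sum-cong : ∀ {n} {f g : Fin n → ℕ} → (∀ i → f i ≡ g i) → sumF f ≡ sumF g
  sum-cong {zero} e = refl
  sum-cong {suc n} e = cong₂ _+_ (e fzero) (sum-cong (e ∘ fsuc))

  sum-mono : ∀ {n} {f g : Fin n → ℕ} → (∀ i → f i ≤ g i) → sumF f ≤ sumF g
  sum-mono {zero} e = z≤n
  sum-mono {suc n} e = +-mono-≤ (e fzero) (sum-mono (e ∘ fsuc))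

  sum-+ : ∀ {n} (f g : Fin n → ℕ) → sumF (λ i → f i + g i) ≡ sumF f + sumF g
  sum-+ {zero} f g = refl
  sum-+ {suc n} f g =
    trans (cong (f fzero + g fzero +_) (sum-+ (f ∘ fsuc) (g ∘ fsuc))) (+-interchange (f fzero) (g fzero) _ _)

  sum-* : ∀ {n} a (f : Fin n → ℕ) → sumF (λ i → a * f i) ≡ a * sumF f
  sum-* {zero} a f = sym (*-zeroʳ a)
  sum-* {suc n} a f = trans (cong (a * f fzero +_) (sum-* a (f ∘ fsuc))) (sym (*-distribˡ-+ a (f fzero) _))

  sum-const : ∀ {n} a → sumF {n} (λ _ → a) ≡ n * a
  sum-const {zero} a = refl
  sum-const {suc n} a = cong (a +_) (sum-const {n} a)

  sum-zero : ∀ n → sumF {n} (λ _ → 0) ≡ 0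
  sum-zero n = trans (sum-const {n} 0) (*-zeroʳ n)

  sum-swap : ∀ {n m} (f : Fin n → Fin m → ℕ) → sumF (λ i → sumF (λ j → f i j)) ≡ sumF (λ j → sumF (λ i → f i j))
  sum-swap {zero} {m} f = sym (sum-zero m)
  sum-swap {suc n} f = trans (cong (sumF (f fzero) +_) (sum-swap (f ∘ fsuc))) (sym (sum-+ (f fzero) _))

  term≤sum : ∀ {n} (f : Fin n → ℕ) i → f i ≤ sumF f
  term≤sum f fzero = m≤m+n _ _
  term≤sum f (fsuc i) = ≤-trans (term≤sum (f ∘ fsuc) i) (m≤n+m _ _)

  fsuc== : ∀ {n} (x a : Fin n) → (fsuc x == fsuc a) ≡ (x == a)
  fsuc== x a with x F.≟ a
  ... | yes _ = refl
  ... | no _ = refl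

  -- `==` acts as a Kronecker delta, which turns case distinctions on a single vertex into algebra
  -- with sums.
  sum-delta : ∀ {n} (x : Fin n) (f : Fin n → ℕ) → sumF (λ a → ι (x == a) * f a) ≡ f x
  sum-delta {suc n} fzero f = trans (cong₂ _+_ (+-identityʳ (f fzero)) (sum-zero n)) (+-identityʳ _)
  sum-delta (fsuc x) f =
    trans (sum-cong (λ a → cong (λ z → ι z * f (fsuc a)) (fsuc== x a))) (sum-delta x (f ∘ fsuc))

  sum-fiber : ∀ {n m} (c : Fin n → Fin m) (f : Fin n → ℕ) → sumF (λ a → sumF (λ v → ι (c v == a) * f v)) ≡ sumF
    f
  sum-fiber c f = trans (sum-swap (λ a v → ι (c v == a) * f v)) (sum-cong (λ v → sum-delta (c v) (λ _ → f v)))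

  sum-update : ∀ {n} (x : Fin n) w (f g : Fin n → ℕ) → g x ≡ f x + w → (∀ v → v ≢ x → g v ≡ f v) → sumF g ≡ sumF
    f + w
  sum-update x w f g gx gv = trans (sum-cong pt) (trans (sum-+ f _) (cong (sumF f +_) (sum-delta x (λ _ → w))))
    where
    pt : ∀ v → g v ≡ f v + ι (x == v) * w
    pt v with x F.≟ v
    ... | yes refl = trans gx (cong (f x +_) (sym (+-identityʳ w)))
    ... | no ne = trans (gv v (ne ∘ sym)) (sym (+-identityʳ _))

  count≡sum : ∀ {n} (p : Fin n → Bool) → countF p ≡ sumF (ι ∘ p)
  count≡sum {zero} p = refl
  count≡sum {suc n} p = cong (ι (p fzero) +_) (count≡sum (p ∘ fsuc))

  count-mono : ∀ {n} {p q : Fin n → Bool} → (∀ v → p v ≡ true → q v ≡ true) → countF p ≤ countF q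
  count-mono {p = p} {q} f rewrite count≡sum p | count≡sum q = sum-mono (λ v → ι-mono (f v))

  count-cong : ∀ {n} {p q : Fin n → Bool} → (∀ v → p v ≡ q v) → countF p ≡ countF q
  count-cong {p = p} {q} f rewrite count≡sum p | count≡sum q = sum-cong (λ v → cong ι (f v))

  count≤n : ∀ {n} (p : Fin n → Bool) → countF p ≤ n
  count≤n {zero} p = z≤n
  count≤n {suc n} p = +-mono-≤ (ι≤1 (p fzero)) (count≤n (p ∘ fsuc))

  exF : ∀ {n} → (Fin n → Bool) → Bool
  exF {zero} p = false
  exF {suc n} p = p fzero ∨ exF (p ∘ fsuc)

  exF-intro : ∀ {n} {p : Fin n → Bool} x → p x ≡ true → exF p ≡ true
  exF-intro {p = p} fzero e rewrite e = refl
  exF-intro {p = p} (fsuc x) e with p fzero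
  ... | true = refl
  ... | false = exF-intro x e

  exF-elim : ∀ {n} {p : Fin n → Bool} → exF p ≡ true → ∃ λ x → p x ≡ true
  exF-elim {suc n} {p} e with p fzero in eq
  ... | true = fzero , eq
  ... | false with exF-elim {n} {p ∘ fsuc} e
  ...   | x , px = fsuc x , px

  ι-exF≤ : ∀ {n} (p : Fin n → Bool) → ι (exF p) ≤ sumF (ι ∘ p)
  ι-exF≤ p with exF p in eq
  ... | false = z≤n
  ... | true with exF-elim {p = p} eq
  ...   | x , px = ≤-trans (≤-reflexive (sym (ι-true px))) (term≤sum (ι ∘ p) x)

  enum : ∀ {n} (p : Fin n → Bool) → Fin (countF p) → Fin n
  enum {suc n} p i with p fzero
  enum {suc n} p fzero | true = fzero
  enum {suc n} p (fsuc i) | true = fsuc (enum (p ∘ fsuc) i)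
  enum {suc n} p i | false = fsuc (enum (p ∘ fsuc) i)

  enum-inj : ∀ {n} (p : Fin n → Bool) {i j} → enum p i ≡ enum p j → i ≡ j
  enum-inj {suc n} p {i} {j} e with p fzero
  enum-inj {suc n} p {fzero} {fzero} e | true = refl
  enum-inj {suc n} p {fsuc i} {fsuc j} e | true = cong fsuc (enum-inj (p ∘ fsuc) (F.suc-injective e))
  enum-inj {suc n} p {i} {j} e | false = enum-inj (p ∘ fsuc) (F.suc-injective e)

  enum-true : ∀ {n} (p : Fin n → Bool) i → p (enum p i) ≡ true
  enum-true {suc n} p i with p fzero in eq
  enum-true {suc n} p fzero | true = eq
  enum-true {suc n} p (fsuc i) | true = enum-true (p ∘ fsuc) i
  enum-true {suc n} p i | false = enum-true (p ∘ fsuc) i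

  sum-enum : ∀ {n} (p : Fin n → Bool) (f : Fin n → ℕ) → sumF (f ∘ enum p) ≡ sumF (λ v → ι (p v) * f v)
  sum-enum {zero} p f = refl
  sum-enum {suc n} p f with p fzero
  ... | true = cong₂ _+_ (sym (+-identityʳ (f fzero))) (sum-enum (p ∘ fsuc) (f ∘ fsuc))
  ... | false = sum-enum (p ∘ fsuc) (f ∘ fsuc)

  count-enum : ∀ {n} (p q : Fin n → Bool) → countF (q ∘ enum p) ≡ countF (λ v → p v ∧ q v)
  count-enum p q =
    trans (count≡sum (q ∘ enum p)) (trans (sum-enum p (ι ∘ q))
      (trans (sum-cong (λ v → sym (ι-∧ (p v) (q v)))) (sym (count≡sum (λ v → p v ∧ q v)))))

  -- Twice the number of edges when the relation is symmetric and irreflexive. Ordered pairs make it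
  -- a plain double sum, which can be estimated without regard to the order of the vertices.
  degsum : ∀ {n} → (Fin n → Fin n → Bool) → ℕ
  degsum r = sumF (λ i → sumF (λ j → ι (r i j)))

  -- Handshake lemma: the strict upper triangle of the adjacency matrix, its transpose and the empty
  -- diagonal make up the whole matrix.
  2edges : ∀ G → 2 * edges G ≡ degsum (adj G)
  2edges G = begin
    2 * edges G ≡⟨ cong (edges G +_) (+-identityʳ _) ⟩
    edges G + edges G ≡⟨ cong₂ _+_ eq1 (trans eq1 (sum-swap up)) ⟩
    sumF (λ i → sumF (λ j → up i j)) + sumF (λ i → sumF (λ j → up j i))
      ≡⟨ sum-+ (λ i → sumF (up i)) (λ i → sumF (λ j → up j i)) ⟨
    sumF (λ i → sumF (λ j → up i j) + sumF (λ j → up j i))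
      ≡⟨ sum-cong (λ i → sym (sum-+ (up i) (λ j → up j i))) ⟩
    sumF (λ i → sumF (λ j → up i j + up j i)) ≡⟨ sum-cong (λ i → sum-cong (λ j → pt i j)) ⟩
    degsum (adj G) ∎
    where
    open ≡-Reasoning
    up : Fin (n G) → Fin (n G) → ℕ
    up i j = ι ((toℕ i <ᵇ toℕ j) ∧ adj G i j)
    eq1 : edges G ≡ sumF (λ i → sumF (λ j → up i j))
    eq1 = sum-cong (λ i → count≡sum (λ j → (toℕ i <ᵇ toℕ j) ∧ adj G i j))
    <ᵇ-yes : ∀ {a b} → a < b → (a <ᵇ b) ≡ true
    <ᵇ-yes {a} {b} lt with a <ᵇ b | <⇒<ᵇ lt
    ... | true | _ = refl
    <ᵇ-no : ∀ {a b} → ¬ (a < b) → (a <ᵇ b) ≡ false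
    <ᵇ-no {a} {b} nlt with a <ᵇ b in eq
    ... | false = refl
    ... | true = ⊥-elim (nlt (<ᵇ⇒< a b (subst (λ z → Data.Bool.T z) (sym eq) _)))
    pt : ∀ i j → up i j + up j i ≡ ι (adj G i j)
    pt i j with <-cmp (toℕ i) (toℕ j)
    ... | tri< lt _ ngt rewrite <ᵇ-yes lt | <ᵇ-no ngt = +-identityʳ _
    ... | tri> nlt _ gt rewrite <ᵇ-yes gt | <ᵇ-no nlt = cong ι (Graph.sym G j i)
    ... | tri≈ nlt eq ngt rewrite F.toℕ-injective eq | irref G j | <ᵇ-no {toℕ j} {toℕ j} (<-irrefl refl) = refl

  -- Subgraphs on a set of vertices

  sub : ∀ {n} (p : Fin n → Bool) (r : Fin n → Fin n → Bool) →
        (∀ u v → r u v ≡ r v u) → (∀ v → r v v ≡ false) → Graph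
  sub p r r-sym r-irr = record
    { n = countF p
    ; adj = λ i j → r (enum p i) (enum p j)
    ; sym = λ i j → r-sym (enum p i) (enum p j)
    ; irref = λ i → r-irr (enum p i)
    }

  on : ∀ {n} → (Fin n → Bool) → (Fin n → Fin n → Bool) → Fin n → Fin n → Bool
  on p r u v = p u ∧ (p v ∧ r u v)

  2edges-sub : ∀ {n} (p : Fin n → Bool) r r-sym r-irr → 2 * edges (sub p r r-sym r-irr) ≡ degsum (on p r)
  2edges-sub p r r-sym r-irr = begin
    2 * edges (sub p r r-sym r-irr) ≡⟨ 2edges (sub p r r-sym r-irr) ⟩
    sumF (λ i → sumF (λ j → ι (r (enum p i) (enum p j))))
      ≡⟨ sum-enum p (λ u → sumF (λ j → ι (r u (enum p j)))) ⟩
    sumF (λ u → ι (p u) * sumF (λ j → ι (r u (enum p j))))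
      ≡⟨ sum-cong (λ u → cong (ι (p u) *_) (sum-enum p (λ v → ι (r u v)))) ⟩
    sumF (λ u → ι (p u) * sumF (λ v → ι (p v) * ι (r u v)))
      ≡⟨ sum-cong (λ u → sum-* (ι (p u)) (λ v → ι (p v) * ι (r u v))) ⟨
    sumF (λ u → sumF (λ v → ι (p u) * (ι (p v) * ι (r u v))))
      ≡⟨ sum-cong (λ u → sum-cong (λ v → trans (cong (ι (p u) *_) (sym (ι-∧ (p v) _))) (sym (ι-∧ (p u) _)))) ⟩
    degsum (on p r) ∎
    where open ≡-Reasoning

  sub⊆ : ∀ G (p : Fin (n G) → Bool) r r-sym r-irr → (∀ u v → r u v ≡ true → adj G u v ≡ true) →
         SubgraphOf (sub p r r-sym r-irr) G
  sub⊆ G p r _ _ r⊆ = record { emb = enum p ; inj = enum-inj p ; presAdj = λ u v → r⊆ (enum p u) (enum p v) }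

  SubgraphOf-refl : ∀ G → SubgraphOf G G
  SubgraphOf-refl G = record { emb = λ v → v ; inj = λ e → e ; presAdj = λ _ _ e → e }

  SubgraphOf-trans : ∀ {H K G} → SubgraphOf H K → SubgraphOf K G → SubgraphOf H G
  SubgraphOf-trans s t = record
    { emb = emb t ∘ emb s
    ; inj = inj s ∘ inj t
    ; presAdj = λ u v e → presAdj t (emb s u) (emb s v) (presAdj s u v e)
    }

  -- A pair that is not inside `p` has an end outside and is charged to it, as first or as second
  -- entry; hence the factor 2.
  degsum-on : ∀ {n} (p : Fin n → Bool) (r : Fin n → Fin n → Bool) → (∀ u v → r u v ≡ r v u) →
              degsum r ≤ degsum (on p r) + 2 * sumF (λ u → ι (not (p u)) * sumF (λ v → ι (r u v)))
  degsum-on {n} p r r-sym = begin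
    degsum r
      ≤⟨ sum-mono (λ u → sum-mono (λ v → pt u v)) ⟩
    sumF (λ u → sumF (λ v → ι (on p r u v) + (out u v + out v u)))
      ≡⟨ sum-cong (λ u → trans (sum-+ (λ v → ι (on p r u v)) (λ v → out u v + out v u))
        (cong (sumF (λ v → ι (on p r u v)) +_) (sum-+ (out u) (λ v → out v u)))) ⟩
    sumF (λ u → sumF (λ v → ι (on p r u v)) + (sumF (out u) + sumF (λ v → out v u)))
      ≡⟨ trans (sum-+ (λ u → sumF (λ v → ι (on p r u v))) (λ u → sumF (out u) + sumF (λ v → out v u)))
        (cong (degsum (on p r) +_) (sum-+ (λ u → sumF (out u)) (λ u → sumF (λ v → out v u)))) ⟩
    degsum (on p r) + (sumF (λ u → sumF (out u)) + sumF (λ u → sumF (λ v → out v u)))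
      ≡⟨ cong (λ z → degsum (on p r) + (sumF (λ u → sumF (out u)) + z)) (sym (sum-swap out)) ⟩
    degsum (on p r) + (sumF (λ u → sumF (out u)) + sumF (λ u → sumF (out u)))
      ≡⟨ cong (degsum (on p r) +_) (trans (cong₂ _+_ eq eq) (cong (total +_) (sym (+-identityʳ total)))) ⟩
    degsum (on p r) + 2 * total ∎
    where
    open ≤-Reasoning
    out : Fin n → Fin n → ℕ
    out u v = ι (not (p u)) * ι (r u v)
    total = sumF (λ u → ι (not (p u)) * sumF (λ v → ι (r u v)))
    eq : sumF (λ u → sumF (out u)) ≡ total
    eq = sum-cong (λ u → sum-* (ι (not (p u))) (λ v → ι (r u v)))
    pt : ∀ u v → ι (r u v) ≤ ι (on p r u v) + (out u v + out v u)
    pt u v with p u | p v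
    ... | true | true = m≤m+n _ _
    ... | true | false = ≤-reflexive (trans (cong ι (r-sym u v)) (sym (+-identityʳ _)))
    ... | false | _ = ≤-trans (≤-reflexive (sym (+-identityʳ _))) (m≤m+n _ _)

  -- Degrees, deletion of a vertex, and subgraphs of large minimum degree.

  deg : ∀ G → Fin (n G) → ℕ
  deg G v = countF (adj G v)

  deg≡ : ∀ G v → deg G v ≡ sumF (λ u → ι (adj G v u))
  deg≡ G v = count≡sum (adj G v)

  edges-pos⇒n-pos : ∀ G → 0 < edges G → 0 < n G
  edges-pos⇒n-pos record { n = suc _ } _ = z<s

  count-but : ∀ {n} (x : Fin n) → 1 + countF (λ v → not (x == v)) ≡ n
  count-but {n} x = begin
    1 + countF (λ v → not (x == v)) ≡⟨ cong suc (count≡sum (λ v → not (x == v))) ⟩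
    1 + sumF (λ v → ι (not (x == v))) ≡⟨ +-comm 1 _ ⟩
    sumF (λ v → ι (not (x == v))) + 1
      ≡⟨ sum-update x 1 (λ v → ι (not (x == v))) (λ _ → 1) (cong (λ z → ι (not z) + 1) (sym (==-refl x)))
        (λ v ne → sym (cong (λ z → ι (not z)) (≢⇒== (ne ∘ sym)))) ⟨
    sumF {n} (λ _ → 1) ≡⟨ sum-const {n} 1 ⟩
    n * 1 ≡⟨ *-identityʳ n ⟩
    n ∎
    where open ≡-Reasoning

  delete : ∀ G → Fin (n G) → Graph
  delete G x = sub (λ v → not (x == v)) (adj G) (Graph.sym G) (irref G)

  edges-delete : ∀ G x → edges G ≤ edges (delete G x) + deg G x
  edges-delete G x = *-cancelˡ-≤ 2 (begin
    2 * edges G ≡⟨ 2edges G ⟩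
    degsum (adj G) ≤⟨ degsum-on p (adj G) (Graph.sym G) ⟩
    degsum (on p (adj G)) + 2 * sumF (λ u → ι (not (p u)) * sumF (λ v → ι (adj G u v)))
      ≡⟨ cong₂ (λ a b → a + 2 * b) (sym (2edges-sub p (adj G) (Graph.sym G) (irref G))) eq ⟩
    2 * edges (delete G x) + 2 * deg G x ≡⟨ *-distribˡ-+ 2 (edges (delete G x)) (deg G x) ⟨
    2 * (edges (delete G x) + deg G x) ∎)
    where
    open ≤-Reasoning
    p = λ v → not (x == v)
    eq : sumF (λ u → ι (not (p u)) * sumF (λ v → ι (adj G u v))) ≡ deg G x
    eq = trans (sum-cong (λ u → cong (λ z → ι z * sumF (λ v → ι (adj G u v))) (Bool.not-involutive (x == u))))
               (trans (sum-delta x (λ u → sumF (λ v → ι (adj G u v)))) (sym (deg≡ G x)))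

  MinDegreeSubgraph : ℕ → ℕ → Graph → Set
  MinDegreeSubgraph e N G =
    Σ Graph λ H → SubgraphOf H G × e * n H ≤ edges H * N × 0 < n H × (∀ v → e ≤ deg H v * N)

  -- The threshold d = `e`/`N` stays fixed while the graph shrinks. Deleting a vertex of degree
  -- below d leaves more than d edges per vertex, with strict inequality; so an edge, and hence a
  -- vertex, always remains. `f` bounds the number of deletions.
  prune : ∀ e N f G → n G ≤ f → 0 < n G → e * n G ≤ edges G * N → MinDegreeSubgraph e N G
  prune e N f G n≤f n>0 dense with F.any? (λ v → suc (deg G v * N) ≤? e)
  ... | no none = G , SubgraphOf-refl G , dense , n>0 , λ v → ≮⇒≥ (λ lt → none (v , lt))
  prune e N zero G n≤f n>0 dense | yes _ = ⊥-elim (<⇒≱ n>0 n≤f)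
  prune e N (suc f) G n≤f n>0 dense | yes (x , low) with prune e N f G′
    (s≤s⁻¹ (≤-trans (≤-reflexive (count-but x)) n≤f)) n′>0 (<⇒≤ dense′)
    where
    G′ = delete G x
    open ≤-Reasoning
    dense′ : e * n G′ < edges G′ * N
    dense′ = +-cancelʳ-< e _ _ (begin-strict
      e * n G′ + e ≡⟨ +-comm _ e ⟩
      e + e * n G′ ≡⟨ *-suc e (n G′) ⟨
      e * (1 + n G′) ≡⟨ cong (e *_) (count-but x) ⟩
      e * n G ≤⟨ dense ⟩
      edges G * N ≤⟨ *-monoˡ-≤ N (edges-delete G x) ⟩
      (edges G′ + deg G x) * N ≡⟨ *-distribʳ-+ N (edges G′) (deg G x) ⟩
      edges G′ * N + deg G x * N <⟨ +-monoʳ-< (edges G′ * N) low ⟩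
      edges G′ * N + e ∎)
    n′>0 : 0 < n G′
    n′>0 = edges-pos⇒n-pos G′ (n≢0⇒n>0 (λ eq → n≮0 (subst (λ z → e * n G′ < z * N) eq dense′)))
  ... | H , s , rest = H , SubgraphOf-trans s (sub⊆ G _ (adj G) (Graph.sym G) (irref G) (λ _ _ r → r)) , rest

  -- Quotients by a labelling of the vertices

  bool-ext : ∀ {a b} → (a ≡ true → b ≡ true) → (b ≡ true → a ≡ true) → a ≡ b
  bool-ext {true} f g = sym (f refl)
  bool-ext {false} {false} f g = refl
  bool-ext {false} {true} f g with g refl
  ... | ()

  -- Union bound: a label that is hit by `s` is charged to a vertex that hits it.
  sum-image : ∀ {n m} (c : Fin n → Fin m) (s : Fin n → Bool) (g : Fin m → ℕ) →
              sumF (λ b → g b * ι (exF (λ v → (c v == b) ∧ s v))) ≤ sumF (λ v → g (c v) * ι (s v))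
  sum-image c s g = begin
    sumF (λ b → g b * ι (exF (λ v → (c v == b) ∧ s v)))
      ≤⟨ sum-mono (λ b → *-monoʳ-≤ (g b) (ι-exF≤ (λ v → (c v == b) ∧ s v))) ⟩
    sumF (λ b → g b * sumF (λ v → ι ((c v == b) ∧ s v)))
      ≡⟨ sum-cong (λ b → sym (sum-* (g b) (λ v → ι ((c v == b) ∧ s v)))) ⟩
    sumF (λ b → sumF (λ v → g b * ι ((c v == b) ∧ s v)))
      ≡⟨ sum-swap (λ b v → g b * ι ((c v == b) ∧ s v)) ⟩
    sumF (λ v → sumF (λ b → g b * ι ((c v == b) ∧ s v)))
      ≡⟨ sum-cong (λ v → trans (sum-cong (λ b → rearr v b)) (sum-delta (c v) (λ b → g b * ι (s v)))) ⟩
    sumF (λ v → g (c v) * ι (s v)) ∎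
    where
    open ≤-Reasoning
    rearr : ∀ v b → g b * ι ((c v == b) ∧ s v) ≡ ι (c v == b) * (g b * ι (s v))
    rearr v b with c v == b
    ... | true = sym (+-identityʳ _)
    ... | false = *-zeroʳ (g b)

  -- Adjacency of the contracted graph, with the labels themselves as vertices. A label that no
  -- vertex carries is isolated, so contractions need no renumbering and empty classes do not affect
  -- `degsum`.
  quot : ∀ {n m} → (Fin n → Fin n → Bool) → (Fin n → Fin m) → Fin m → Fin m → Bool
  quot r c a b = not (a == b) ∧ exF (λ u → (c u == a) ∧ exF (λ v → (c v == b) ∧ r u v))

  quot-intro : ∀ {n m} {r : Fin n → Fin n → Bool} (c : Fin n → Fin m) {u v} → c u ≢ c v → r u v ≡ true → quot r
    c (c u) (c v) ≡ true
  quot-intro c {u} {v} ne e =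
    ∧-intro (not-false (≢⇒== ne)) (exF-intro u
      (∧-intro (==-refl (c u)) (exF-intro v (∧-intro (==-refl (c v)) e))))

  quot-elim : ∀ {n m} {r : Fin n → Fin n → Bool} (c : Fin n → Fin m) {a b} → quot r c a b ≡ true →
              a ≢ b × ∃ λ u → ∃ λ v → c u ≡ a × c v ≡ b × r u v ≡ true
  quot-elim c {a} {b} e with exF-elim (∧-snd {not (a == b)} e)
  ... | u , eu with exF-elim (∧-snd {c u == a} eu)
  ...   | v , ev = ==⇒≢ (not-true (∧-fst e)) , u , v , ==⇒≡ (∧-fst eu) , ==⇒≡ (∧-fst ev) , ∧-snd {c v == b} ev

  quot-sym : ∀ {n m} {r : Fin n → Fin n → Bool} (c : Fin n → Fin m) → (∀ u v → r u v ≡ r v u) → ∀ a b → quot r c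
    a b ≡ quot r c b a
  quot-sym {r = r} c r-sym a b = bool-ext (flip′ a b) (flip′ b a)
    where
    flip′ : ∀ a b → quot r c a b ≡ true → quot r c b a ≡ true
    flip′ a b e with quot-elim c e
    ... | ne , u , v , refl , refl , ruv = quot-intro c (ne ∘ sym) (trans (r-sym v u) ruv)

  quot-irr : ∀ {n m} {r : Fin n → Fin n → Bool} (c : Fin n → Fin m) a → quot r c a a ≡ false
  quot-irr c a rewrite ==-refl a = refl

  -- Each adjacent pair of classes is charged to an edge of `r` that realises it, and the weight `f`
  -- depends on the classes only. The two applications of `sum-image` choose the two ends of that
  -- edge.
  sum-quot : ∀ {n m} (r : Fin n → Fin n → Bool) (c : Fin n → Fin m) (f : Fin m → Fin m → ℕ) →
             sumF (λ a → sumF (λ b → f a b * ι (quot r c a b))) ≤ sumF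
               (λ u → sumF (λ v → f (c u) (c v) * ι (r u v)))
  sum-quot {n} {m} r c f = begin
    sumF (λ a → sumF (λ b → f a b * ι (quot r c a b)))
      ≤⟨ sum-mono (λ a → sum-mono (λ b → *-monoʳ-≤ (f a b) (ι-mono (∧-snd {not (a == b)})))) ⟩
    sumF (λ a → sumF (λ b → f a b * ι (exF (λ u → (c u == a) ∧ R u b))))
      ≡⟨ sum-swap (λ a b → f a b * ι (exF (λ u → (c u == a) ∧ R u b))) ⟩
    sumF (λ b → sumF (λ a → f a b * ι (exF (λ u → (c u == a) ∧ R u b))))
      ≤⟨ sum-mono (λ b → sum-image c (λ u → R u b) (λ a → f a b)) ⟩
    sumF (λ b → sumF (λ u → f (c u) b * ι (R u b)))
      ≡⟨ sum-swap (λ b u → f (c u) b * ι (R u b)) ⟩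
    sumF (λ u → sumF (λ b → f (c u) b * ι (R u b)))
      ≤⟨ sum-mono (λ u → sum-image c (r u) (f (c u))) ⟩
    sumF (λ u → sumF (λ v → f (c u) (c v) * ι (r u v))) ∎
    where
    open ≤-Reasoning
    R : Fin n → Fin m → Bool
    R u b = exF (λ v → (c v == b) ∧ r u v)

  degsum-mono : ∀ {n} {r s : Fin n → Fin n → Bool} → (∀ u v → r u v ≡ true → s u v ≡ true) → degsum r ≤ degsum s
  degsum-mono f = sum-mono (λ u → sum-mono (λ v → ι-mono (f u v)))

  degsum-quot : ∀ {n m} (r : Fin n → Fin n → Bool) (c : Fin n → Fin m) → degsum (quot r c) ≤ degsum r
  degsum-quot r c = begin
    degsum (quot r c) ≡⟨ sum-cong (λ a → sum-cong (λ b → sym (+-identityʳ (ι (quot r c a b))))) ⟩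
    sumF (λ a → sumF (λ b → 1 * ι (quot r c a b))) ≤⟨ sum-quot r c (λ _ _ → 1) ⟩
    sumF (λ u → sumF (λ v → 1 * ι (r u v))) ≡⟨ sum-cong (λ a → sum-cong (λ b → +-identityʳ (ι (r a b)))) ⟩
    degsum r ∎
    where open ≤-Reasoning

  -- The coarser quotient is itself a quotient of the finer one by `g`, and contraction creates no
  -- edges.
  quot-refine : ∀ {n m l} (r : Fin n → Fin n → Bool) (c : Fin n → Fin m) (s : Fin n → Fin l)
    (g : Fin l → Fin m) → (∀ v → c v ≡ g (s v)) → degsum (quot r c) ≤ degsum (quot r s)
  quot-refine r c s g eq = ≤-trans (degsum-mono step′) (degsum-quot (quot r s) g)
    where
    step′ : ∀ a b → quot r c a b ≡ true → quot (quot r s) g a b ≡ true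
    step′ a b e with quot-elim c e
    ... | ne , u , v , refl , refl , ruv rewrite eq u | eq v =
      quot-intro g ne (quot-intro s (ne ∘ cong g) ruv)

  -- Merging two classes and the edges lost by it.

  common : ∀ {n m} → (Fin n → Fin n → Bool) → (Fin n → Fin m) → Fin m → Fin m → ℕ
  common r c a b = countF (λ w → quot r c a w ∧ quot r c b w)

  merge : ∀ {n m} → (Fin n → Fin m) → Fin m → Fin m → Fin n → Fin m
  merge c C D v = if c v == C then D else c v

  merge-eq : ∀ {n m} (c : Fin n → Fin m) {C} D {v} → c v ≡ C → merge c C D v ≡ D
  merge-eq c {C} D {v} refl rewrite ==-refl (c v) = refl

  merge-ne : ∀ {n m} (c : Fin n → Fin m) {C} D {v} → c v ≢ C → merge c C D v ≡ c v
  merge-ne c D ne rewrite ≢⇒== ne = refl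

  module _ {n m} {r : Fin n → Fin n → Bool} (r-sym : ∀ u v → r u v ≡ r v u) (c : Fin n → Fin m) {C D : Fin m} where
    private
      c′ = merge c C D
      q = quot r c
      q′ = quot r c′

      new : Fin m → Bool
      new b = q C b ∧ (not (q D b) ∧ not (D == b))

      keep : ∀ {a b} → a ≢ C → b ≢ C → q a b ≡ true → q′ a b ≡ true
      keep a≢ b≢ e with quot-elim c e
      ... | ne , u , v , refl , refl , ruv =
        subst₂ (λ a b → q′ a b ≡ true) (merge-ne c D a≢) (merge-ne c D b≢)
          (quot-intro c′ (λ eq → ne (trans (sym (merge-ne c D a≢)) (trans eq (merge-ne c D b≢)))) ruv)

      move : ∀ {b} → b ≢ D → q C b ≡ true → q′ D b ≡ true
      move b≢D e with quot-elim c e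
      ... | ne , u , v , cu , refl , ruv =
        subst₂ (λ a b → q′ a b ≡ true) (merge-eq c D cu) (merge-ne c D (ne ∘ sym))
          (quot-intro c′ (λ eq → b≢D (sym (trans (sym (merge-eq c D cu)) (trans eq (merge-ne c D (ne ∘ sym))))))
            ruv)

      rest : Fin m → Bool
      rest a = not (C == a)

      kept : ∀ a b → on rest q a b ≡ true → q′ a b ≡ true
      kept a b e = keep (ne a (∧-fst e)) (ne b (∧-fst (∧-snd {rest a} e))) (∧-snd {rest b} (∧-snd {rest a} e))
        where
        ne : ∀ a → rest a ≡ true → a ≢ C
        ne a e refl = ==⇒≢ (not-true e) refl

      new-D : ∀ {b} → new b ≡ true → q D b ≡ false
      new-D {b} e = not-true (∧-fst (∧-snd {q C b} e))

      new-≢ : ∀ {b} → new b ≡ true → b ≢ D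
      new-≢ {b} e refl = ==⇒≢ (not-true (∧-snd {not (q D b)} (∧-snd {q C b} e))) refl

      row : ∀ b → ι (on rest q D b) + ι (new b) ≤ ι (q′ D b)
      row b with new b in eq
      ... | false = ≤-trans (≤-reflexive (+-identityʳ _)) (ι-mono (kept D b))
      ... | true with on rest q D b in eq′
      ...   | false = ≤-reflexive (sym (ι-true (move (new-≢ {b} eq) (∧-fst eq))))
      ...   | true = ⊥-elim (true≢false (∧-snd {rest b} (∧-snd {rest D} eq′)) (new-D {b} eq))

      col : ∀ a → ι (on rest q a D) + ι (new a) ≤ ι (q′ a D)
      col a = subst₂ (λ x y → x + ι (new a) ≤ y) (cong ι on-sym) (cong ι (quot-sym c′ r-sym D a)) (row a)
        where
        on-sym : on rest q D a ≡ on rest q a D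
        on-sym rewrite quot-sym {r = r} c r-sym D a with rest D | rest a
        ... | true | true = refl
        ... | true | false = refl
        ... | false | true = refl
        ... | false | false = refl

      -- The extra terms lie in the row and the column of D, where D inherits neighbours from C.
      -- They could meet only at (D, D), where `new` is false.
      cell : ∀ a b → ι (on rest q a b) + (ι (D == a) * ι (new b) + ι (D == b) * ι (new a)) ≤ ι (q′ a b)
      cell a b = cases (D == a) (D == b) refl refl
        where
        cases : ∀ s t → (D == a) ≡ s → (D == b) ≡ t → ι (on rest q a b) + (ι s * ι (new b) + ι t * ι (new a)) ≤
          ι (q′ a b)
        cases false false _ _ = ≤-trans (≤-reflexive (+-identityʳ _)) (ι-mono (kept a b))
        cases true false ea _ with refl ← ==⇒≡ ea =
          ≤-trans (≤-reflexive (cong (ι (on rest q D b) +_) (trans (+-identityʳ _) (+-identityʳ _)))) (row b)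
        cases false true _ eb with refl ← ==⇒≡ eb =
          ≤-trans (≤-reflexive (cong (ι (on rest q a D) +_) (+-identityʳ _))) (col a)
        cases true true ea eb with refl ← ==⇒≡ ea | refl ← ==⇒≡ eb with new D in eq
        ... | true = ⊥-elim (new-≢ {D} eq refl)
        ... | false = ≤-trans (≤-reflexive (+-identityʳ _)) (ι-mono (kept D D))

      gained : degsum (on rest q) + 2 * sumF (ι ∘ new) ≤ degsum q′
      gained = begin
        degsum (on rest q) + 2 * S ≡⟨ cong (λ z → degsum (on rest q) + (S + z)) (+-identityʳ S) ⟩
        degsum (on rest q) + (S + S)
          ≡⟨ cong₂ (λ x y → degsum (on rest q) + (x + y)) S≡
            (trans S≡ (sum-swap (λ a b → ι (D == a) * ι (new b)))) ⟩
        degsum (on rest q) + (sumF (λ a → sumF (λ b → ι (D == a) * ι (new b))) + sumF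
          (λ a → sumF (λ b → ι (D == b) * ι (new a))))
          ≡⟨ cong (degsum (on rest q) +_)
            (trans (sym (sum-+ (λ a → sumF (λ b → ι (D == a) * ι (new b)))
              (λ a → sumF (λ b → ι (D == b) * ι (new a)))))
                (sum-cong (λ a → sym (sum-+ (λ b → ι (D == a) * ι (new b)) (λ b → ι (D == b) * ι (new a)))))) ⟩
        degsum (on rest q) + sumF (λ a → sumF (extra a))
          ≡⟨ trans (sym (sum-+ (λ a → sumF (λ b → ι (on rest q a b))) (λ a → sumF (extra a))))
            (sum-cong (λ a → sym (sum-+ (λ b → ι (on rest q a b)) (extra a)))) ⟩
        sumF (λ a → sumF (λ b → ι (on rest q a b) + extra a b)) ≤⟨ sum-mono (λ a → sum-mono (λ b → cell a b)) ⟩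
        degsum q′ ∎
        where
        open ≤-Reasoning
        S = sumF (ι ∘ new)
        extra : Fin m → Fin m → ℕ
        extra a b = ι (D == a) * ι (new b) + ι (D == b) * ι (new a)
        S≡ : S ≡ sumF (λ a → sumF (λ b → ι (D == a) * ι (new b)))
        S≡ = trans (sym (sum-delta D (λ _ → S))) (sum-cong (λ a → sym (sum-* (ι (D == a)) (ι ∘ new))))

      lost : sumF (λ b → ι (q C b)) ≤ sumF (ι ∘ new) + (1 + common r c C D)
      lost = begin
        sumF (λ b → ι (q C b)) ≤⟨ sum-mono pt ⟩
        sumF (λ b → ι (new b) + (ι (D == b) * 1 + ι (q C b ∧ q D b)))
          ≡⟨ trans (sum-+ (ι ∘ new) (λ b → ι (D == b) * 1 + ι (q C b ∧ q D b)))
            (cong (sumF (ι ∘ new) +_) (sum-+ (λ b → ι (D == b) * 1) (λ b → ι (q C b ∧ q D b)))) ⟩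
        sumF (ι ∘ new) + (sumF (λ b → ι (D == b) * 1) + sumF (λ b → ι (q C b ∧ q D b)))
          ≡⟨ cong₂ (λ x y → sumF (ι ∘ new) + (x + y)) (sum-delta D (λ _ → 1))
            (sym (count≡sum (λ b → q C b ∧ q D b))) ⟩
        sumF (ι ∘ new) + (1 + common r c C D) ∎
        where
        open ≤-Reasoning
        pt : ∀ b → ι (q C b) ≤ ι (new b) + (ι (D == b) * 1 + ι (q C b ∧ q D b))
        pt b = cases (q C b) (q D b) (D == b)
          where
          cases : ∀ x y z → ι x ≤ ι (x ∧ (not y ∧ not z)) + (ι z * 1 + ι (x ∧ y))
          cases false _ _ = z≤n
          cases true true z = m≤n+m 1 (ι z * 1)
          cases true false true = ≤-refl
          cases true false false = ≤-refl

    -- Only the edge between C and D and one edge to each common neighbour disappear;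
    -- `new` lists the neighbours that D gains.
    degsum-merge : degsum (quot r c) ≤ degsum (quot r (merge c C D)) + 2 * (1 + common r c C D)
    degsum-merge = begin
      degsum q ≤⟨ degsum-on rest q (quot-sym c r-sym) ⟩
      degsum (on rest q) + 2 * sumF (λ a → ι (not (rest a)) * sumF (λ b → ι (q a b)))
        ≡⟨ cong (λ z → degsum (on rest q) + 2 * z)
          (trans (sum-cong (λ a → cong (λ z → ι z * sumF (λ b → ι (q a b))) (Bool.not-involutive (C == a))))
            (sum-delta C (λ a → sumF (λ b → ι (q a b))))) ⟩
      degsum (on rest q) + 2 * sumF (λ b → ι (q C b)) ≤⟨ +-monoʳ-≤ (degsum (on rest q)) (*-monoʳ-≤ 2 lost) ⟩
      degsum (on rest q) + 2 * (sumF (ι ∘ new) + (1 + common r c C D))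
        ≡⟨ trans (cong (degsum (on rest q) +_) (*-distribˡ-+ 2 (sumF (ι ∘ new)) (1 + common r c C D)))
          (sym (+-assoc (degsum (on rest q)) _ _)) ⟩
      degsum (on rest q) + 2 * sumF (ι ∘ new) + 2 * (1 + common r c C D) ≤⟨ +-monoˡ-≤ _ gained ⟩
      degsum q′ + 2 * (1 + common r c C D) ∎
      where
      open ≤-Reasoning

  -- Classes of a labelling, and walks inside them

  ⌊⌋-true : ∀ {P : Set} (d : Dec P) → P → ⌊ d ⌋ ≡ true
  ⌊⌋-true (yes _) _ = refl
  ⌊⌋-true (no ¬p) p = ⊥-elim (¬p p)

  ⌊⌋-elim : ∀ {P : Set} (d : Dec P) → ⌊ d ⌋ ≡ true → P
  ⌊⌋-elim (yes p) _ = p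

  ⌊⌋-false : ∀ {P : Set} (d : Dec P) → ⌊ d ⌋ ≡ false → ¬ P
  ⌊⌋-false (no ¬p) _ = ¬p

  size : ∀ {n m} → (Fin n → Fin m) → Fin m → ℕ
  size c a = countF (λ v → c v == a)

  size-merge-≢ : ∀ {n m} (c : Fin n → Fin m) {C D a} → a ≢ D → size (merge c C D) a ≤ size c a
  size-merge-≢ c {C} {D} {a} a≢D = count-mono pt
    where
    pt : ∀ v → (merge c C D v == a) ≡ true → (c v == a) ≡ true
    pt v e with c v F.≟ C
    ... | yes _ = ⊥-elim (a≢D (sym (==⇒≡ e)))
    ... | no _ = e

  size-merge : ∀ {n m} (c : Fin n → Fin m) C D → size (merge c C D) D ≤ size c C + size c D
  size-merge c C D = begin
    size (merge c C D) D ≡⟨ count≡sum (λ v → merge c C D v == D) ⟩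
    sumF (λ v → ι (merge c C D v == D)) ≤⟨ sum-mono pt ⟩
    sumF (λ v → ι (c v == C) + ι (c v == D)) ≡⟨ sum-+ (λ v → ι (c v == C)) (λ v → ι (c v == D)) ⟩
    sumF (λ v → ι (c v == C)) + sumF (λ v → ι (c v == D))
      ≡⟨ cong₂ _+_ (count≡sum (λ v → c v == C)) (count≡sum (λ v → c v == D)) ⟨
    size c C + size c D ∎
    where
    open ≤-Reasoning
    pt : ∀ v → ι (merge c C D v == D) ≤ ι (c v == C) + ι (c v == D)
    pt v with c v F.≟ C
    ... | yes _ = ≤-trans (ι≤1 (D == D)) (m≤m+n 1 _)
    ... | no _ = ≤-refl

  size-merge-bound : ∀ {n m} (c : Fin n → Fin m) {s C D} → (∀ a → size c a ≤ s) → size c C + size c D ≤ s → ∀ a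
    → size (merge c C D) a ≤ s
  size-merge-bound c {D = D} bound CD a with a F.≟ D
  ... | yes refl = ≤-trans (size-merge c _ D) CD
  ... | no ne = ≤-trans (size-merge-≢ c ne) (bound a)

  -- Labels are vertices; idempotence puts every label that is used into its own class, so nonempty
  -- classes correspond to fixed points, and `classes` counts these.
  Idempotent : ∀ {n} → (Fin n → Fin n) → Set
  Idempotent c = ∀ v → c (c v) ≡ c v

  classes : ∀ {n} → (Fin n → Fin n) → ℕ
  classes c = countF (λ a → c a == a)

  merge-idem : ∀ {n} (c : Fin n → Fin n) → Idempotent c → ∀ {x y} → c x ≢ c y → Idempotent (merge c (c x) (c y))
  merge-idem c idem {x} {y} ne v with c v F.≟ c x
  ... | yes _ = trans (merge-ne c (c y) (λ e → ne (trans (sym e) (idem y)))) (idem y)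
  ... | no cv≢ = trans (merge-ne c (c y) (λ e → cv≢ (trans (sym (idem v)) e))) (idem v)

  -- `c x` stops being a fixed point and no new fixed point arises.
  classes-merge : ∀ {n} (c : Fin n → Fin n) → Idempotent c → ∀ {x y} → c x ≢ c y → 1 + classes
    (merge c (c x) (c y)) ≤ classes c
  classes-merge c idem {x} {y} ne = begin
    1 + classes c′ ≡⟨ cong₂ _+_ (sym (sum-delta (c x) (λ _ → 1))) (count≡sum (λ a → c′ a == a)) ⟩
    sumF (λ a → ι (c x == a) * 1) + sumF (λ a → ι (c′ a == a))
      ≡⟨ sum-+ (λ a → ι (c x == a) * 1) (λ a → ι (c′ a == a)) ⟨
    sumF (λ a → ι (c x == a) * 1 + ι (c′ a == a)) ≤⟨ sum-mono pt ⟩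
    sumF (λ a → ι (c a == a)) ≡⟨ count≡sum (λ a → c a == a) ⟨
    classes c ∎
    where
    open ≤-Reasoning
    c′ = merge c (c x) (c y)
    fixed : ∀ a → c′ a ≡ a → c a ≡ a × c x ≢ a
    fixed a e with c a F.≟ c x
    ... | yes ca = ⊥-elim (ne (trans (sym ca) (trans (cong c (sym e)) (idem y))))
    ... | no ca≢ = e , λ eq → ca≢ (trans (trans e (sym eq)) refl)
    cases : ∀ a s → (c x == a) ≡ s → ι s * 1 + ι (c′ a == a) ≤ ι (c a == a)
    cases a false _ = ι-mono (λ e → trans (cong (_== a) (proj₁ (fixed a (==⇒≡ e)))) (==-refl a))
    cases a true e with refl ← ==⇒≡ e =
      ≤-reflexive (trans (cong suc (ι-false (≢⇒== (λ e′ → proj₂ (fixed (c x) e′) refl))))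
        (sym (ι-true (trans (cong (_== c x) (idem x)) (==-refl (c x))))))
    pt : ∀ a → ι (c x == a) * 1 + ι (c′ a == a) ≤ ι (c a == a)
    pt a = cases a (c x == a) refl

  walk-mono : ∀ {G S S′ u v} → (∀ w → S w ≡ true → S′ w ≡ true) → WalkIn G S u v → WalkIn G S′ u v
  walk-mono f (here s) = here (f _ s)
  walk-mono f (step s e w) = step (f _ s) e (walk-mono f w)

  walk-++ : ∀ {G S u v w} → WalkIn G S u v → WalkIn G S v w → WalkIn G S u w
  walk-++ (here _) q = q
  walk-++ (step s e p) q = step s e (walk-++ p q)

  walk-start : ∀ {G S u v} → WalkIn G S u v → S u ≡ true
  walk-start (here s) = s
  walk-start (step s _ _) = s

  walk-reverse : ∀ {G S u v} → WalkIn G S u v → WalkIn G S v u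
  walk-reverse (here s) = here s
  walk-reverse {G} (step {u} {w} s e p) =
    walk-++ (walk-reverse p) (step (walk-start p) (trans (Graph.sym G w u) e) (here s))

  -- Connectedness in a form that survives merging: only walks to the label have to be maintained,
  -- and any two vertices of a class are then joined through it.
  Rooted : (G : Graph) → (Fin (n G) → Fin (n G)) → Set
  Rooted G c = ∀ v → WalkIn G (λ u → c u == c v) v (c v)

  rooted⇒connected : ∀ G c → Rooted G c → ∀ a → Connected G (λ u → c u == a)
  rooted⇒connected G c rooted a u v eu ev with refl ← ==⇒≡ eu =
    walk-++ (rooted u) (walk-reverse (subst (λ a → WalkIn G (λ w → c w == a) v a) (==⇒≡ ev) (rooted v)))

  -- A vertex of the absorbed class walks to its old label, from there back to `x`, over the edge to
  -- `y`, and on to the label of `y`.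
  merge-rooted : ∀ G c → Rooted G c → ∀ {x y} → adj G x y ≡ true → c x ≢ c y → Rooted G (merge c (c x) (c y))
  merge-rooted G c rooted {x} {y} xy ne v = cases (c v F.≟ c x)
    where
    c′ = merge c (c x) (c y)
    into : ∀ {w} → c w ≡ c x ⊎ c w ≡ c y → (c′ w == c y) ≡ true
    into (inj₁ e) = trans (cong (_== c y) (merge-eq c (c y) e)) (==-refl (c y))
    into (inj₂ e) =
      trans (cong (_== c y) (trans (merge-ne c (c y) (λ e′ → ne (trans (sym e′) e))) e)) (==-refl (c y))
    cases : Dec (c v ≡ c x) → WalkIn G (λ u → c′ u == c′ v) v (c′ v)
    cases (no ne′) = subst (λ a → WalkIn G (λ u → c′ u == a) v a) (sym (merge-ne c (c y) ne′))
      (walk-mono (λ w e → trans (cong (_== c v) (merge-ne c (c y) (λ e′ → ne′ (trans (sym (==⇒≡ e)) e′)))) e)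
        (rooted v))
    cases (yes e) = subst (λ a → WalkIn G (λ u → c′ u == a) v a) (sym (merge-eq c (c y) e))
      (walk-++ (walk-mono (λ w e → into (inj₁ (==⇒≡ e)))
        (subst (λ a → WalkIn G (λ w → c w == a) v a) e (rooted v)))
      (walk-++ (walk-mono (λ w e → into (inj₁ (==⇒≡ e))) (walk-reverse (rooted x)))
      (step (into (inj₁ refl)) xy (walk-mono (λ w e → into (inj₂ (==⇒≡ e))) (rooted y)))))

  fiber-bound : ∀ {n m k} (c : Fin n → Fin m) → (∀ a → size c a ≤ k) → (p : Fin m → Bool) → sumF
    (λ v → ι (p (c v))) ≤ k * sumF (ι ∘ p)
  fiber-bound {k = k} c bound p = begin
    sumF (λ v → ι (p (c v))) ≡⟨ sum-fiber c (λ v → ι (p (c v))) ⟨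
    sumF (λ a → sumF (λ v → ι (c v == a) * ι (p (c v))))
      ≡⟨ sum-cong (λ a → trans (sum-cong (λ v → pt a v)) (sum-* (ι (p a)) (λ v → ι (c v == a)))) ⟩
    sumF (λ a → ι (p a) * sumF (λ v → ι (c v == a)))
      ≡⟨ sum-cong (λ a → cong (ι (p a) *_) (sym (count≡sum (λ v → c v == a)))) ⟩
    sumF (λ a → ι (p a) * size c a)
      ≤⟨ sum-mono (λ a → ≤-trans (*-monoʳ-≤ (ι (p a)) (bound a)) (≤-reflexive (*-comm (ι (p a)) k))) ⟩
    sumF (λ a → k * ι (p a)) ≡⟨ sum-* k (ι ∘ p) ⟩
    k * sumF (ι ∘ p) ∎
    where
    open ≤-Reasoning
    cases : ∀ a v → Dec (c v ≡ a) → ι (c v == a) * ι (p (c v)) ≡ ι (p a) * ι (c v == a)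
    cases a v (yes refl) = *-comm (ι (c v == c v)) _
    cases a v (no ne) rewrite ≢⇒== ne = sym (*-zeroʳ (ι (p a)))
    pt : ∀ a v → ι (c v == a) * ι (p (c v)) ≡ ι (p a) * ι (c v == a)
    pt a v = cases a v (c v F.≟ a)

  quot-degree : ∀ {m} G (c : Fin (n G) → Fin m) a → sumF (λ b → ι (quot (adj G) c a b)) ≤ sumF
    (λ u → ι (c u == a) * deg G u)
  quot-degree G c a = begin
    sumF (λ b → ι (quot (adj G) c a b)) ≡⟨ sum-delta a (λ x → sumF (λ b → ι (quot (adj G) c x b))) ⟨
    sumF (λ x → ι (a == x) * sumF (λ b → ι (quot (adj G) c x b)))
      ≡⟨ sum-cong (λ x → sum-* (ι (a == x)) (λ b → ι (quot (adj G) c x b))) ⟨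
    sumF (λ x → sumF (λ b → ι (a == x) * ι (quot (adj G) c x b))) ≤⟨ sum-quot (adj G) c (λ x _ → ι (a == x)) ⟩
    sumF (λ u → sumF (λ v → ι (a == c u) * ι (adj G u v)))
      ≡⟨ sum-cong (λ u → sum-* (ι (a == c u)) (λ v → ι (adj G u v))) ⟩
    sumF (λ u → ι (a == c u) * sumF (λ v → ι (adj G u v)))
      ≡⟨ sum-cong (λ u → cong₂ _*_ (cong ι (==-sym a (c u))) (sym (deg≡ G u))) ⟩
    sumF (λ u → ι (c u == a) * deg G u) ∎
    where open ≤-Reasoning

  -- If many classes D met by the neighbourhood of x had more than b neighbours in common with the class
  -- of x, they would span, together with the classes adjacent to x, a small set T with many edges.
  module _ (G : Graph) (k B b m : ℕ)
    (sparse : ∀ (T : Fin (n G) → Bool) p → countF T ≤ k * (k * B) + k * B →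
              p * (1 + b) ≤ degsum (on T (adj G)) → k * p ≤ m)
    (c : Fin (n G) → Fin (n G)) (bound : ∀ a → size c a ≤ k)
    (x : Fin (n G)) (low : ∀ v → c v ≡ c x → deg G v ≤ B) where
    private
      V = Fin (n G)
      q = quot (adj G) c
      C = c x

      bad : V → Bool
      bad D = not (D == C) ∧ ⌊ b <? common (adj G) c C D ⌋

      nbr : V → Bool
      nbr D = exF (λ y → (c y == D) ∧ adj G x y)

      P : V → Bool
      P D = nbr D ∧ bad D

      p = sumF (ι ∘ P)

      T : V → Bool
      T v = P (c v) ∨ q C (c v)

      ι-∨ : ∀ s t → ι (s ∨ t) ≤ ι s + ι t
      ι-∨ true t = m≤m+n 1 _
      ι-∨ false t = ≤-refl

      p≤B : p ≤ B
      p≤B = begin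
        p ≤⟨ sum-mono (λ D → ι-mono (∧-fst {nbr D})) ⟩
        sumF (λ D → ι (nbr D)) ≡⟨ sum-cong (λ D → sym (+-identityʳ (ι (nbr D)))) ⟩
        sumF (λ D → 1 * ι (nbr D)) ≤⟨ sum-image c (adj G x) (λ _ → 1) ⟩
        sumF (λ y → 1 * ι (adj G x y)) ≡⟨ sum-cong (λ y → +-identityʳ (ι (adj G x y))) ⟩
        sumF (λ y → ι (adj G x y)) ≡⟨ deg≡ G x ⟨
        deg G x ≤⟨ low x refl ⟩
        B ∎
        where open ≤-Reasoning

      qC≤ : sumF (λ w → ι (q C w)) ≤ k * B
      qC≤ = begin
        sumF (λ w → ι (q C w)) ≤⟨ quot-degree G c C ⟩
        sumF (λ u → ι (c u == C) * deg G u) ≤⟨ sum-mono (λ u → ι*-≤ (c u == C) (λ e → low u (==⇒≡ e))) ⟩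
        sumF (λ u → ι (c u == C) * B) ≡⟨ sum-cong (λ u → *-comm (ι (c u == C)) B) ⟩
        sumF (λ u → B * ι (c u == C)) ≡⟨ sum-* B (λ u → ι (c u == C)) ⟩
        B * sumF (λ u → ι (c u == C)) ≡⟨ cong (B *_) (count≡sum (λ u → c u == C)) ⟨
        B * size c C ≤⟨ *-monoʳ-≤ B (bound C) ⟩
        B * k ≡⟨ *-comm B k ⟩
        k * B ∎
        where open ≤-Reasoning

      -- At most `B` classes are in `P`, since each contains a neighbour of `x`. At most k`B`
      -- classes are adjacent to C, since C has at most k vertices, all of degree at most `B`.
      T≤ : countF T ≤ k * (k * B) + k * B
      T≤ = begin
        countF T ≡⟨ count≡sum T ⟩
        sumF (ι ∘ T) ≤⟨ sum-mono (λ v → ι-∨ (P (c v)) (q C (c v))) ⟩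
        sumF (λ v → ι (P (c v)) + ι (q C (c v))) ≡⟨ sum-+ (λ v → ι (P (c v))) (λ v → ι (q C (c v))) ⟩
        sumF (λ v → ι (P (c v))) + sumF (λ v → ι (q C (c v)))
          ≤⟨ +-mono-≤ (fiber-bound c bound P) (fiber-bound c bound (q C)) ⟩
        k * p + k * sumF (λ w → ι (q C w)) ≤⟨ +-mono-≤ (*-monoʳ-≤ k p≤B) (*-monoʳ-≤ k qC≤) ⟩
        k * B + k * (k * B) ≡⟨ +-comm (k * B) _ ⟩
        k * (k * B) + k * B ∎
        where open ≤-Reasoning

      -- For D in `P` and a common neighbour w of C and D, some edge of G leads from D to w, and
      -- both classes lie inside `T`. Different pairs (D, w) give different ordered pairs of
      -- vertices, so nothing is lost even where `P` overlaps the neighbourhood of C.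
      dense : p * (1 + b) ≤ degsum (on T (adj G))
      dense = begin
        p * (1 + b) ≡⟨ *-comm p (1 + b) ⟩
        (1 + b) * p ≡⟨ sum-* (1 + b) (ι ∘ P) ⟨
        sumF (λ D → (1 + b) * ι (P D))
          ≤⟨ sum-mono (λ D → ≤-trans (≤-reflexive (*-comm (1 + b) (ι (P D))))
            (ι*-≤ (P D) (λ e → ⌊⌋-elim (b <? _) (∧-snd {not (D == C)} (∧-snd {nbr D} e))))) ⟩
        sumF (λ D → ι (P D) * common (adj G) c C D)
          ≡⟨ sum-cong (λ D → cong (ι (P D) *_) (count≡sum (λ w → q C w ∧ q D w))) ⟩
        sumF (λ D → ι (P D) * sumF (λ w → ι (q C w ∧ q D w)))
          ≡⟨ sum-cong (λ D → sum-* (ι (P D)) (λ w → ι (q C w ∧ q D w))) ⟨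
        sumF (λ D → sumF (λ w → ι (P D) * ι (q C w ∧ q D w)))
          ≡⟨ sum-cong (λ D → sum-cong (λ w → trans (cong (ι (P D) *_) (ι-∧ (q C w) (q D w)))
            (sym (*-assoc (ι (P D)) _ _)))) ⟩
        sumF (λ D → sumF (λ w → (ι (P D) * ι (q C w)) * ι (q D w)))
          ≤⟨ sum-quot (adj G) c (λ D w → ι (P D) * ι (q C w)) ⟩
        sumF (λ u → sumF (λ v → (ι (P (c u)) * ι (q C (c v))) * ι (adj G u v)))
          ≤⟨ sum-mono (λ u → sum-mono (λ v → pt (P (c u)) (q C (c u)) (P (c v)) (q C (c v)) (adj G u v))) ⟩
        degsum (on T (adj G)) ∎
        where
        open ≤-Reasoning
        pt : ∀ a a′ b b′ e → (ι a * ι b′) * ι e ≤ ι ((a ∨ a′) ∧ ((b ∨ b′) ∧ e))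
        pt false a′ b b′ e = z≤n
        pt true a′ b false e = z≤n
        pt true a′ true true e = ≤-reflexive (+-identityʳ (ι e))
        pt true a′ false true e = ≤-reflexive (+-identityʳ (ι e))

    few-bad-neighbours : countF (λ y → adj G x y ∧ (not (c y == c x) ∧ ⌊ b <? common (adj G) c (c x) (c y) ⌋)) ≤
      m
    few-bad-neighbours = begin
      countF (λ y → adj G x y ∧ bad (c y)) ≡⟨ count≡sum (λ y → adj G x y ∧ bad (c y)) ⟩
      sumF (λ y → ι (adj G x y ∧ bad (c y)))
        ≤⟨ sum-mono (λ y → ι-mono (λ e → ∧-intro (exF-intro y (∧-intro (==-refl (c y)) (∧-fst e)))
          (∧-snd {adj G x y} e))) ⟩
      sumF (λ y → ι (P (c y))) ≤⟨ fiber-bound c bound P ⟩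
      k * p ≤⟨ sparse T p T≤ dense ⟩
      m ∎
      where open ≤-Reasoning

  -- Contracting sparse graphs

  count-∪ : ∀ {n} {p q r : Fin n → Bool} → (∀ v → p v ≡ true → q v ≡ true ⊎ r v ≡ true) → countF p ≤ countF q +
    countF r
  count-∪ {p = p} {q} {r} f = begin
    countF p ≡⟨ count≡sum p ⟩
    sumF (ι ∘ p) ≤⟨ sum-mono pt ⟩
    sumF (λ v → ι (q v) + ι (r v)) ≡⟨ sum-+ (ι ∘ q) (ι ∘ r) ⟩
    sumF (ι ∘ q) + sumF (ι ∘ r) ≡⟨ cong₂ _+_ (count≡sum q) (count≡sum r) ⟨
    countF q + countF r ∎
    where
    open ≤-Reasoning
    pt : ∀ v → ι (p v) ≤ ι (q v) + ι (r v)
    pt v with p v in eq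
    ... | false = z≤n
    ... | true with f v eq
    ...   | inj₁ e = ≤-trans (≤-reflexive (sym (ι-true e))) (m≤m+n _ _)
    ...   | inj₂ e = ≤-trans (≤-reflexive (sym (ι-true e))) (m≤n+m _ _)

  exF-false : ∀ {n} {p : Fin n → Bool} → exF p ≡ false → ∀ x → p x ≡ true → ⊥
  exF-false e x px = true≢false (exF-intro x px) e

  size-id : ∀ {n} (a : Fin n) → size (λ v → v) a ≡ 1
  size-id a =
    trans (count≡sum (λ v → v == a))
      (trans (sum-cong (λ v → trans (cong ι (==-sym v a)) (sym (*-identityʳ _)))) (sum-delta a (λ _ → 1)))

  -- An interface free of ε and d: `sparse` and `balanced` are what the failures of (i) and (ii)
  -- provide, and `Θ` r stands for r ≥ (1 - 2kε)d. The `2 * m + h` in `degree` is the number of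
  -- neighbours that an unattachable vertex may have outside the full classes.
  module Contraction (G : Graph) (k ℓ h B b m : ℕ) (Θ : ℕ → Set)
    (Θ-mono : ∀ {r s} → r ≤ s → Θ r → Θ s)
    (h>0 : 1 ≤ h) (cap : (1 + ℓ) * (2 * h) ≤ k)
    (sparse : ∀ (T : Fin (n G) → Bool) p → countF T ≤ k * (k * B) + k * B →
              p * (1 + b) ≤ degsum (on T (adj G)) → k * p ≤ m)
    (balanced : ∀ (X Y : Fin (n G) → Bool) → (∀ v → X v ≡ true → Y v ≡ false) →
                (∀ x → X x ≡ true → Θ (countF (λ y → adj G x y ∧ Y y))) → countF X ≤ ℓ * countF Y)
    (degree : ∀ v r → deg G v ≤ r + (2 * m + h) → Θ r)
    where

    V = Fin (n G)
    r = adj G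
    -- The price of one cheap contraction in `degsum`: the edge between the two classes and one edge
    -- for each of at most `b` common neighbours, all counted twice.
    κ = 2 * (1 + b)

    Φ : (V → V) → ℕ
    Φ c = degsum (quot r c)

    2h≤k : 2 * h ≤ k
    2h≤k = ≤-trans (m≤m+n (2 * h) _) cap

    -- The weight of a big vertex makes its class heavy, so a light class is small and has no big vertex.
    wt : V → ℕ
    wt v = if ⌊ B <? deg G v ⌋ then 1 + h else 1

    1≤wt : ∀ v → 1 ≤ wt v
    1≤wt v with ⌊ B <? deg G v ⌋
    ... | true = s≤s z≤n
    ... | false = ≤-refl

    weight : (V → V) → V → ℕ
    weight c a = sumF (λ v → ι (c v == a) * wt v)

    light : (V → V) → V → Bool
    light c a = ⌊ weight c a ≤? h ⌋

    size≤weight : ∀ c a → size c a ≤ weight c a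
    size≤weight c a =
      ≤-trans (≤-reflexive (count≡sum (λ v → c v == a)))
        (sum-mono (λ v → ≤-trans (≤-reflexive (sym (*-identityʳ _))) (*-monoʳ-≤ (ι (c v == a)) (1≤wt v))))

    light⇒size≤h : ∀ c {a} → light c a ≡ true → size c a ≤ h
    light⇒size≤h c {a} e = ≤-trans (size≤weight c a) (⌊⌋-elim (weight c a ≤? h) e)

    light⇒low : ∀ c {v} → light c (c v) ≡ true → deg G v ≤ B
    light⇒low c {v} e with B <? deg G v in eq
    ... | no ¬big = ≮⇒≥ ¬big
    ... | yes _ = ⊥-elim (<⇒≱ (n<1+n h) (begin
      1 + h ≡⟨ cong (λ z → if ⌊ z ⌋ then 1 + h else 1) eq ⟨
      wt v ≡⟨ +-identityʳ (wt v) ⟨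
      1 * wt v ≡⟨ cong (_* wt v) (ι-true (==-refl (c v))) ⟨
      ι (c v == c v) * wt v ≤⟨ term≤sum (λ u → ι (c u == c v) * wt u) v ⟩
      weight c (c v) ≤⟨ ⌊⌋-elim (weight c (c v) ≤? h) e ⟩
      h ∎))
      where open ≤-Reasoning

    -- `loss` says, without subtraction, that starting from `total` each of the `n G` - `classes c`
    -- contractions has cost at most `κ`.
    record Clustering (c : V → V) (s total : ℕ) : Set where
      field
        idem    : Idempotent c
        rooted  : Rooted G c
        bounded : ∀ a → size c a ≤ s
        loss    : total + κ * classes c ≤ Φ c + κ * n G
    open Clustering

    merge-clustering : ∀ {c s total x y} → Clustering c s total → adj G x y ≡ true → c x ≢ c y →
      common r c (c x) (c y) ≤ b → size c (c x) + size c (c y) ≤ s → Clustering (merge c (c x) (c y)) s total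
    merge-clustering {c} {s} {total} {x} {y} cl xy ne few sz = record
      { idem = merge-idem c (idem cl) ne
      ; rooted = merge-rooted G c (rooted cl) xy ne
      ; bounded = size-merge-bound c (bounded cl) sz
      ; loss = +-cancelʳ-≤ κ _ _ (begin
          total + κ * classes c′ + κ ≡⟨ lem total κ (classes c′) ⟩
          total + κ * (1 + classes c′) ≤⟨ +-monoʳ-≤ total (*-monoʳ-≤ κ (classes-merge c (idem cl) ne)) ⟩
          total + κ * classes c ≤⟨ loss cl ⟩
          Φ c + κ * n G ≤⟨ +-monoˡ-≤ (κ * n G) (degsum-merge (Graph.sym G) c) ⟩
          Φ c′ + 2 * (1 + common r c (c x) (c y)) + κ * n G
            ≤⟨ +-monoˡ-≤ (κ * n G) (+-monoʳ-≤ (Φ c′) (*-monoʳ-≤ 2 (s≤s few))) ⟩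
          Φ c′ + κ + κ * n G ≡⟨ lem₂ (Φ c′) κ (κ * n G) ⟩
          Φ c′ + κ * n G + κ ∎)
      }
      where
      open ≤-Reasoning
      c′ = merge c (c x) (c y)
      lem : ∀ t κ x → t + κ * x + κ ≡ t + κ * (1 + x)
      lem = solve-∀
      lem₂ : ∀ p κ x → p + κ + x ≡ p + x + κ
      lem₂ = solve-∀

    mergeable : (V → V) → V → V → Bool
    mergeable c x y =
      adj G x y ∧ (not (c x == c y) ∧ (light c (c x) ∧ (light c (c y) ∧ ⌊ common r c (c x) (c y) ≤? b ⌋)))

    Stuck : (V → V) → Set
    Stuck c = ∀ x y → mergeable c x y ≡ true → ⊥

    -- Only light classes are merged. These have at most `h` vertices each, whence the bound
    -- `2 * h`. The number of classes drops each time, so `f` bounds the number of merges.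
    grow : ∀ f c → classes c ≤ f → Clustering c (2 * h) (degsum r) →
           Σ (V → V) λ c → Clustering c (2 * h) (degsum r) × Stuck c
    grow f c cf cl with exF (λ x → exF (λ y → mergeable c x y)) in eq
    ... | false = c , cl , λ x y e → exF-false eq x (exF-intro y e)
    ... | true with exF-elim eq
    ...   | x , ex with exF-elim ex
    ...     | y , e = go f cf
      where
      ne : c x ≢ c y
      ne = ==⇒≢ (not-true (∧-fst (∧-snd {adj G x y} e)))
      e₁ : (light c (c x) ∧ (light c (c y) ∧ ⌊ common r c (c x) (c y) ≤? b ⌋)) ≡ true
      e₁ = ∧-snd {not (c x == c y)} (∧-snd {adj G x y} e)
      e₂ : (light c (c y) ∧ ⌊ common r c (c x) (c y) ≤? b ⌋) ≡ true
      e₂ = ∧-snd {light c (c x)} e₁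
      cl′ : Clustering (merge c (c x) (c y)) (2 * h) (degsum r)
      cl′ = merge-clustering cl (∧-fst e) ne (⌊⌋-elim (_ ≤? b) (∧-snd {light c (c y)} e₂))
        (+-mono-≤ (light⇒size≤h c (∧-fst e₁))
          (≤-trans (light⇒size≤h c (∧-fst e₂)) (≤-reflexive (sym (+-identityʳ h)))))
      go : ∀ f → classes c ≤ f → Σ (V → V) λ c → Clustering c (2 * h) (degsum r) × Stuck c
      go zero cf = ⊥-elim (n≮0 (≤-trans (classes-merge c (idem cl) ne) cf))
      go (suc f) cf = grow f (merge c (c x) (c y)) (s≤s⁻¹ (≤-trans (classes-merge c (idem cl) ne) cf)) cl′

    discrete : Clustering (λ v → v) (2 * h) (degsum r)
    discrete = record
      { idem = λ _ → refl
      ; rooted = λ v → here (==-refl v)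
      ; bounded = λ a → ≤-trans (≤-reflexive (size-id a)) (≤-trans h>0 (m≤m+n h _))
      ; loss = +-mono-≤ (degsum-mono {r = r} {s = quot r (λ v → v)}
        (λ u v e → quot-intro {r = r} (λ v → v) {u} {v} (λ { refl → true≢false e (irref G u) }) e))
          (*-monoʳ-≤ κ {classes {n G} (λ v → v)} (count≤n (λ (a : V) → a == a)))
      }

    -- Attaching the vertices of the light classes to the other classes.

    module Attach (c₁ : V → V) (cl₁ : Clustering c₁ (2 * h) (degsum r)) (stuck : Stuck c₁) where

      X Y : V → Bool
      X v = light c₁ (c₁ v)
      Y v = not (X v)

      X⇒¬Y : ∀ {v} → X v ≡ true → Y v ≡ true → ⊥
      X⇒¬Y x y = true≢false x (not-true y)

      X⊎Y : ∀ v → X v ≡ true ⊎ Y v ≡ true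
      X⊎Y v with X v
      ... | true = inj₁ refl
      ... | false = inj₂ refl

      Y-c₁ : ∀ {v} → Y v ≡ true → Y (c₁ v) ≡ true
      Y-c₁ {v} e = trans (cong (λ a → not (light c₁ a)) (idem cl₁ v)) e

      low : ∀ {v} → X v ≡ true → deg G v ≤ B
      low e = light⇒low c₁ e

      -- The light class of `x` accounts for at most `h` neighbours. A neighbour in another light
      -- class is a bad one, for otherwise the two classes could still be merged; there are at most
      -- `m` of these.
      few-X : ∀ x → X x ≡ true → countF (λ y → adj G x y ∧ X y) ≤ h + m
      few-X x Xx = ≤-trans (count-∪ split) (+-mono-≤ (light⇒size≤h c₁ Xx)
        (few-bad-neighbours G k B b m sparse c₁ (λ a → ≤-trans (bounded cl₁ a) 2h≤k) x
          (λ v e → low (trans (cong (light c₁) e) Xx))))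
        where
        split : ∀ y → adj G x y ∧ X y ≡ true → (c₁ y == c₁ x) ≡ true ⊎ adj G x y ∧
          (not (c₁ y == c₁ x) ∧ ⌊ b <? common r c₁ (c₁ x) (c₁ y) ⌋) ≡ true
        split y e with c₁ y F.≟ c₁ x
        ... | yes _ = inj₁ refl
        ... | no ne =
                inj₂ (∧-intro (∧-fst {adj G x y} e)
                  (⌊⌋-true (b <? common r c₁ (c₁ x) (c₁ y))
                    (≰⇒> (λ le → stuck x y (∧-intro (∧-fst {adj G x y} e)
                (∧-intro (not-false (≢⇒== (ne ∘ sym)))
                  (∧-intro Xx (∧-intro (∧-snd {adj G x y} e)
                    (⌊⌋-true (common r c₁ (c₁ x) (c₁ y) ≤? b) le)))))))))

      -- The light classes are dissolved again; every class that remains has more than h vertices or a big vertex.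
      s₀ : V → V
      s₀ v = if X v then v else c₁ v

      s₀-X : ∀ {v} → X v ≡ true → s₀ v ≡ v
      s₀-X e rewrite e = refl

      s₀-Y : ∀ {v} → Y v ≡ true → s₀ v ≡ c₁ v
      s₀-Y e rewrite not-true e = refl

      -- Attached vertices are left out: only the old vertices of a saturated class form the smaller
      -- side in (ii), which is what gives the ratio ℓ.
      full : (V → V) → V → Bool
      full c y = Y y ∧ ⌊ k ≤? size c (c y) ⌋

      A : (V → V) → V → Bool
      A c v = X v ∧ not (c v == v)

      U : (V → V) → (V → Bool) → V → Bool
      U c done v = X v ∧ (done v ∧ (c v == v))

      mass : (V → Bool) → ℕ
      mass p = sumF (λ v → ι (p v) * deg G v)

      -- `done` marks the vertices of X already treated, in order of decreasing degree, and δ is the current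
      -- degree. A is the set of attached vertices, U the set of those for which no attachment was possible.
      -- Since ∣U∣ ≤ ∣A∣ at all times, `balance` survives lowering δ, and at δ = 0 it bounds the degrees lost
      -- by deleting U.
      record Stage (c : V → V) (done : V → Bool) (δ : ℕ) : Set where
        field
          clus    : Clustering c k (Φ s₀)
          onY     : ∀ v → Y v ≡ true → c v ≡ c₁ v
          onX     : ∀ v → X v ≡ true → c v ≡ v ⊎ Y (c v) ≡ true
          fresh   : ∀ v → X v ≡ true → done v ≡ false → c v ≡ v
          blocked : ∀ u → X u ≡ true → done u ≡ true → c u ≡ u → Θ (countF (λ y → adj G u y ∧ full c y))
          balance : mass (U c done) + δ * countF (A c) ≤ mass (A c) + δ * countF (U c done)
          top     : ∀ v → X v ≡ true → done v ≡ false → deg G v ≤ δ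
      open Stage

      module _ {c done δ} (st : Stage c done δ) where

        -- Attaching always keeps the label in `Y`, so a vertex of `X` can label no class other than
        -- itself alone.
        single : ∀ {x v} → X x ≡ true → c v ≡ x → v ≡ x
        single {x} {v} Xx e with X⊎Y v
        ... | inj₂ Yv = ⊥-elim (X⇒¬Y Xx (subst (λ z → Y z ≡ true) (trans (sym (onY st v Yv)) e) (Y-c₁ Yv)))
        ... | inj₁ Xv with onX st v Xv
        ...   | inj₁ cv = trans (sym cv) e
        ...   | inj₂ Ycv = ⊥-elim (X⇒¬Y Xx (subst (λ z → Y z ≡ true) e Ycv))

        -- A class of size k has at most 2h vertices in Y, so at least 2hℓ attached ones.
        saturated : ∀ a → ℓ * sumF (λ v → ι (c v == a) * ι (full c v)) ≤ sumF (λ v → ι (c v == a) * ι (A c v))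
        saturated a with exF (λ v → (c v == a) ∧ full c v) in eq
        ... | false =
                ≤-trans (≤-reflexive (trans (cong (ℓ *_) (trans (sum-cong zero-term) (sum-zero (n G))))
                  (*-zeroʳ ℓ))) z≤n
          where
          zero-term : ∀ v → ι (c v == a) * ι (full c v) ≡ 0
          zero-term v = trans (sym (ι-∧ (c v == a) (full c v))) (ι-false (neither ((c v == a) ∧ full c v) refl))
            where
            neither : ∀ t → (c v == a) ∧ full c v ≡ t → (c v == a) ∧ full c v ≡ false
            neither true e = ⊥-elim (exF-false eq v e)
            neither false e = e
        ... | true with exF-elim eq
        ...   | w , ew = +-cancelˡ-≤ F _ _ (begin
          F + ℓ * F ≤⟨ *-monoʳ-≤ (1 + ℓ) F≤2h ⟩
          (1 + ℓ) * (2 * h) ≤⟨ cap ⟩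
          k ≤⟨ k≤size ⟩
          size c a ≡⟨ count≡sum (λ v → c v == a) ⟩
          sumF (λ v → ι (c v == a)) ≤⟨ sum-mono cover ⟩
          sumF (λ v → ι (c v == a) * ι (full c v) + ι (c v == a) * ι (A c v))
            ≡⟨ sum-+ (λ v → ι (c v == a) * ι (full c v)) (λ v → ι (c v == a) * ι (A c v)) ⟩
          F + sumF (λ v → ι (c v == a) * ι (A c v)) ∎)
          where
          open ≤-Reasoning
          F = sumF (λ v → ι (c v == a) * ι (full c v))
          cw : c w ≡ a
          cw = ==⇒≡ (∧-fst ew)
          Yw : Y w ≡ true
          Yw = ∧-fst (∧-snd {c w == a} ew)
          Ya : Y a ≡ true
          Ya = subst (λ z → Y z ≡ true) (trans (sym (onY st w Yw)) cw) (Y-c₁ Yw)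
          k≤size : k ≤ size c a
          k≤size = subst (λ z → k ≤ size c z) cw (⌊⌋-elim (k ≤? _) (∧-snd {Y w} (∧-snd {c w == a} ew)))
          F≤2h : F ≤ 2 * h
          F≤2h = begin
            F
              ≤⟨ sum-mono (λ v → ≤-trans (≤-reflexive (sym (ι-∧ (c v == a) (full c v))))
                (ι-mono (λ e → trans (cong (_== a) (sym (onY st v (∧-fst (∧-snd {c v == a} e))))) (∧-fst e)))) ⟩
            sumF (λ v → ι (c₁ v == a)) ≡⟨ count≡sum (λ v → c₁ v == a) ⟨
            size c₁ a ≤⟨ bounded cl₁ a ⟩
            2 * h ∎
          cover : ∀ v → ι (c v == a) ≤ ι (c v == a) * ι (full c v) + ι (c v == a) * ι (A c v)
          cover v with c v == a in ev
          ... | false = z≤n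
          ... | true with X⊎Y v
          ...   | inj₂ Yv =
                  ≤-trans (≤-reflexive (sym (ι-true
                    (∧-intro Yv (⌊⌋-true (k ≤? _) (subst (λ z → k ≤ size c z) (sym (==⇒≡ ev)) k≤size))))))
                      (≤-trans (≤-reflexive (sym (+-identityʳ _))) (m≤m+n _ _))
          ...   | inj₁ Xv =
                  ≤-trans (≤-reflexive (sym (ι-true
                    (∧-intro Xv (not-false (≢⇒== (λ cv → X⇒¬Y Xv
                      (subst (λ z → Y z ≡ true) (trans (sym (==⇒≡ ev)) cv) Ya))))))))
                        (≤-trans (≤-reflexive (sym (+-identityʳ _))) (m≤n+m _ (1 * ι (full c v))))

        -- `blocked` makes `U` and the full vertices a candidate for (ii), so its failure gives ∣U∣
        -- ≤ ℓ∣full∣. Summing `saturated` over all classes gives ℓ∣full∣ ≤ ∣A∣.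
        U≤A : countF (U c done) ≤ countF (A c)
        U≤A = begin
          countF (U c done) ≤⟨ balanced (U c done) (full c) disj bl ⟩
          ℓ * countF (full c) ≡⟨ cong (ℓ *_) (trans (count≡sum (full c)) (sym (sum-fiber c (ι ∘ full c)))) ⟩
          ℓ * sumF (λ a → sumF (λ v → ι (c v == a) * ι (full c v)))
            ≡⟨ sum-* ℓ (λ a → sumF (λ v → ι (c v == a) * ι (full c v))) ⟨
          sumF (λ a → ℓ * sumF (λ v → ι (c v == a) * ι (full c v))) ≤⟨ sum-mono saturated ⟩
          sumF (λ a → sumF (λ v → ι (c v == a) * ι (A c v)))
            ≡⟨ trans (sum-fiber c (ι ∘ A c)) (sym (count≡sum (A c))) ⟩
          countF (A c) ∎
          where
          open ≤-Reasoning
          disj : ∀ v → U c done v ≡ true → full c v ≡ false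
          disj v e rewrite ∧-fst {X v} e = refl
          bl : ∀ u → U c done u ≡ true → Θ (countF (λ y → adj G u y ∧ full c y))
          bl u e = blocked st u (∧-fst e) (∧-fst (∧-snd {X u} e)) (==⇒≡ (∧-snd {done u} (∧-snd {X u} e)))

      mark : (V → Bool) → V → V → Bool
      mark done x v = (x == v) ∨ done v

      mark-self : ∀ done x → mark done x x ≡ true
      mark-self done x rewrite ==-refl x = refl

      mark-other : ∀ done {x v} → v ≢ x → mark done x v ≡ done v
      mark-other done ne rewrite ≢⇒== (ne ∘ sym) = refl

      mark-false : ∀ done {x v} → mark done x v ≡ false → v ≢ x × done v ≡ false
      mark-false done {x} {v} e = ne , trans (sym (mark-other done ne)) e
        where
        ne : v ≢ x
        ne refl = true≢false (mark-self done x) e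

      mass-update : ∀ {x} {p q : V → Bool} → p x ≡ false → q x ≡ true → (∀ v → v ≢ x → q v ≡ p v) →
                    mass q ≡ mass p + deg G x
      mass-update {x} {p} {q} px qx eq =
        sum-update x (deg G x) (λ v → ι (p v) * deg G v) (λ v → ι (q v) * deg G v)
        (trans (cong (λ z → ι z * deg G x) qx)
          (trans (+-identityʳ _) (sym (cong (λ z → ι z * deg G x + deg G x) px))))
        (λ v ne → cong (λ z → ι z * deg G v) (eq v ne))

      count-update : ∀ {x} {p q : V → Bool} → p x ≡ false → q x ≡ true → (∀ v → v ≢ x → q v ≡ p v) →
                     countF q ≡ countF p + 1
      count-update {x} {p} {q} px qx eq = trans (count≡sum q) (trans (sum-update x 1 (ι ∘ p) (ι ∘ q)
        (trans (ι-true qx) (sym (cong (λ z → ι z + 1) px))) (λ v ne → cong ι (eq v ne)))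
          (cong (_+ 1) (sym (count≡sum p))))

      module _ {c done δ} (st : Stage c done δ) {x : V} (Xx : X x ≡ true) (new : done x ≡ false) (dx : deg G x ≡ δ) where
        private
          done′ = mark done x
          cx : c x ≡ x
          cx = fresh st x Xx new

        -- No vertex of `Y` leaves its class and classes in `Y` only grow, so full vertices stay
        -- full and `blocked` persists. `U` is unchanged, while `A` gains `x` of degree δ: both
        -- sides of `balance` grow by δ.
        attach-one : ∀ {y} → adj G x y ≡ true → Y y ≡ true → size c (c y) < k → common r c (c x) (c y) ≤ b →
                     Stage (merge c (c x) (c y)) done′ δ
        attach-one {y} xy Yy room few = record
          { clus = merge-clustering (clus st) xy ne few (≤-trans (+-monoˡ-≤ (size c (c y)) size-x) room)
          ; onY = λ v Yv → trans (other (Y≢x Yv)) (onY st v Yv)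
          ; onX = onX′
          ; fresh = λ v Xv e → trans (other (proj₁ (mark-false done e)))
            (fresh st v Xv (proj₂ (mark-false done e)))
          ; blocked = blocked′
          ; balance = balance′
          ; top = λ v Xv e → top st v Xv (proj₂ (mark-false done e))
          }
          where
          c′ = merge c (c x) (c y)
          Ycy : Y (c y) ≡ true
          Ycy = subst (λ z → Y z ≡ true) (sym (onY st y Yy)) (Y-c₁ Yy)
          Y≢x : ∀ {v} → Y v ≡ true → v ≢ x
          Y≢x Yv refl = X⇒¬Y Xx Yv
          ne : c x ≢ c y
          ne e = Y≢x Ycy (trans (sym e) cx)
          c′x : c′ x ≡ c y
          c′x = merge-eq c (c y) refl
          other : ∀ {v} → v ≢ x → c′ v ≡ c v
          other v≢x = merge-ne c (c y) (λ e → v≢x (single st Xx (trans e cx)))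
          size-x : size c (c x) ≤ 1
          size-x =
            ≤-trans (count-mono {q = λ v → v == x}
              (λ v e → trans (cong (_== x) (single st Xx (trans (==⇒≡ e) cx))) (==-refl x)))
                (≤-reflexive (size-id x))
          onX′ : ∀ v → X v ≡ true → c′ v ≡ v ⊎ Y (c′ v) ≡ true
          onX′ v Xv with v F.≟ x
          ... | yes refl = inj₂ (subst (λ z → Y z ≡ true) (sym c′x) Ycy)
          ... | no v≢x = subst (λ z → z ≡ v ⊎ Y z ≡ true) (sym (other v≢x)) (onX st v Xv)
          full-mono : ∀ w → full c w ≡ true → full c′ w ≡ true
          full-mono w e = ∧-intro Yw (⌊⌋-true (k ≤? size c′ (c′ w)) (begin
            k ≤⟨ ⌊⌋-elim (k ≤? size c (c w)) (∧-snd {Y w} e) ⟩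
            size c (c w)
              ≤⟨ count-mono {p = λ v → c v == c w} {q = λ v → c′ v == c w}
                (λ v e′ → trans (cong (_== c w) (other {v} (λ { refl → Y≢x Ycw (trans (sym (==⇒≡ e′)) cx) })))
                  e′) ⟩
            size c′ (c w) ≡⟨ cong (size c′) (other (Y≢x Yw)) ⟨
            size c′ (c′ w) ∎))
            where
            open ≤-Reasoning
            Yw : Y w ≡ true
            Yw = ∧-fst e
            Ycw : Y (c w) ≡ true
            Ycw = subst (λ z → Y z ≡ true) (sym (onY st w Yw)) (Y-c₁ Yw)
          blocked′ : ∀ u → X u ≡ true → done′ u ≡ true → c′ u ≡ u → Θ (countF (λ y → adj G u y ∧ full c′ y))
          blocked′ u Xu du cu =
            Θ-mono (count-mono (λ v e → ∧-intro (∧-fst {adj G u v} e) (full-mono v (∧-snd {adj G u v} e))))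
            (blocked st u Xu (trans (sym (mark-other done u≢x)) du) (trans (sym (other u≢x)) cu))
            where
            u≢x : u ≢ x
            u≢x refl = Y≢x Ycy (trans (sym c′x) cu)
          U-same : ∀ v → U c′ done′ v ≡ U c done v
          U-same v with v F.≟ x
          ... | no v≢x = cong₂ (λ s t → X v ∧ (s ∧ (t == v))) (mark-other done v≢x) (other v≢x)
          ... | yes refl =
                  trans (cong₂ _∧_ Xx (cong₂ _∧_ (mark-self done x) (≢⇒== (λ e → Y≢x Ycy (trans (sym c′x) e)))))
                                 (sym (cong₂ _∧_ Xx (cong (_∧ (c x == x)) new)))
          A-old : A c x ≡ false
          A-old = trans (cong₂ _∧_ Xx (cong (λ z → not (z == x)) cx)) (cong not (==-refl x))
          A-new : A c′ x ≡ true
          A-new = ∧-intro Xx (not-false (≢⇒== (λ e → Y≢x Ycy (trans (sym c′x) e))))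
          A-other : ∀ v → v ≢ x → A c′ v ≡ A c v
          A-other v v≢x = cong (λ z → X v ∧ not (z == v)) (other v≢x)
          balance′ : mass (U c′ done′) + δ * countF (A c′) ≤ mass (A c′) + δ * countF (U c′ done′)
          balance′ = begin
            mass (U c′ done′) + δ * countF (A c′)
              ≡⟨ cong₂ (λ s t → s + δ * t) (sum-cong (λ v → cong (λ z → ι z * deg G v) (U-same v)))
                (count-update A-old A-new A-other) ⟩
            mass (U c done) + δ * (countF (A c) + 1) ≡⟨ lem (mass (U c done)) δ (countF (A c)) ⟩
            mass (U c done) + δ * countF (A c) + δ ≤⟨ +-monoˡ-≤ δ (balance st) ⟩
            mass (A c) + δ * countF (U c done) + δ ≡⟨ lem₂ (mass (A c)) δ (δ * countF (U c done)) ⟩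
            mass (A c) + δ + δ * countF (U c done)
              ≡⟨ cong₂ (λ s t → s + δ * t) (trans (cong (mass (A c) +_) (sym dx))
                (sym (mass-update A-old A-new A-other))) (sym (count-cong U-same)) ⟩
            mass (A c′) + δ * countF (U c′ done′) ∎
            where
            open ≤-Reasoning
            lem : ∀ s d t → s + d * (t + 1) ≡ s + d * t + d
            lem = solve-∀
            lem₂ : ∀ s d t → s + t + d ≡ s + d + t
            lem₂ = solve-∀

        -- The neighbours of `x` that are not full lie in `X`, at most `h + m` of them, or in a
        -- class with room but too many common neighbours, at most `m`. This is the `2 * m + h` in
        -- `degree`, and it makes `x` blocked. Both sides of `balance` grow by δ again, now because
        -- `x` joins `U`.
        skip-one : (∀ y → adj G x y ≡ true → Y y ≡ true → size c (c y) < k → b < common r c (c x) (c y)) → Stage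
          c done′ δ
        skip-one unattachable = record
          { clus = clus st
          ; onY = onY st
          ; onX = onX st
          ; fresh = λ v Xv e → fresh st v Xv (proj₂ (mark-false done e))
          ; blocked = blocked′
          ; balance = balance′
          ; top = λ v Xv e → top st v Xv (proj₂ (mark-false done e))
          }
          where
          bad : V → Bool
          bad y = adj G x y ∧ (not (c y == c x) ∧ ⌊ b <? common r c (c x) (c y) ⌋)
          split₁ : ∀ y → adj G x y ≡ true → adj G x y ∧ full c y ≡ true ⊎ (adj G x y ∧ X y ∨ bad y) ≡ true
          split₁ y xy with X⊎Y y
          ... | inj₁ Xy = inj₂ (cong (_∨ bad y) (∧-intro xy Xy))
          ... | inj₂ Yy = room? (k ≤? size c (c y))
            where
            ∨-right : ∀ {s t} → t ≡ true → (s ∨ t) ≡ true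
            ∨-right {true} _ = refl
            ∨-right {false} e = e
            room? : Dec (k ≤ size c (c y)) → adj G x y ∧ full c y ≡ true ⊎ (adj G x y ∧ X y ∨ bad y) ≡ true
            room? (yes none) = inj₁ (∧-intro xy (∧-intro Yy (⌊⌋-true (k ≤? size c (c y)) none)))
            room? (no small) =
              inj₂ (∨-right {adj G x y ∧ X y}
                (∧-intro xy (∧-intro (not-false (≢⇒== distinct))
                  (⌊⌋-true (b <? common r c (c x) (c y)) (unattachable y xy Yy (≰⇒> small))))))
              where
              distinct : c y ≢ c x
              distinct e = X⇒¬Y Xx (subst (λ z → Y z ≡ true) (trans (sym (onY st y Yy)) (trans e cx)) (Y-c₁ Yy))
          split₂ : ∀ y → (adj G x y ∧ X y ∨ bad y) ≡ true → adj G x y ∧ X y ≡ true ⊎ bad y ≡ true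
          split₂ y e with adj G x y ∧ X y
          ... | true = inj₁ refl
          ... | false = inj₂ e
          -- An untreated `x` is alone in its class, so the degree bound is needed only for `x`, and
          -- `low` supplies it.
          bad≤m : countF bad ≤ m
          bad≤m =
            few-bad-neighbours G k B b m sparse c (bounded (clus st)) x
              (λ v e → subst (λ z → deg G z ≤ B) (sym (single st Xx (trans e cx))) (low Xx))
          many : Θ (countF (λ y → adj G x y ∧ full c y))
          many = degree x _ (begin
            deg G x ≤⟨ count-∪ split₁ ⟩
            F + countF (λ y → adj G x y ∧ X y ∨ bad y)
              ≤⟨ +-monoʳ-≤ F (≤-trans (count-∪ split₂) (+-mono-≤ (few-X x Xx) bad≤m)) ⟩
            F + (h + m + m) ≡⟨ cong (F +_) (lem h m) ⟩
            F + (2 * m + h) ∎)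
            where
            open ≤-Reasoning
            F = countF (λ y → adj G x y ∧ full c y)
            lem : ∀ h m → h + m + m ≡ 2 * m + h
            lem = solve-∀
          blocked′ : ∀ u → X u ≡ true → done′ u ≡ true → c u ≡ u → Θ (countF (λ y → adj G u y ∧ full c y))
          blocked′ u Xu du cu with u F.≟ x
          ... | yes refl = many
          ... | no u≢x = blocked st u Xu (trans (sym (mark-other done u≢x)) du) cu
          U-old : U c done x ≡ false
          U-old = cong₂ _∧_ Xx (cong (_∧ (c x == x)) new)
          U-new : U c done′ x ≡ true
          U-new = ∧-intro Xx (∧-intro (mark-self done x) (trans (cong (_== x) cx) (==-refl x)))
          U-other : ∀ v → v ≢ x → U c done′ v ≡ U c done v
          U-other v v≢x = cong (λ z → X v ∧ (z ∧ (c v == v))) (mark-other done v≢x)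
          balance′ : mass (U c done′) + δ * countF (A c) ≤ mass (A c) + δ * countF (U c done′)
          balance′ = begin
            mass (U c done′) + δ * countF (A c)
              ≡⟨ cong (_+ δ * countF (A c)) (trans (mass-update U-old U-new U-other)
                (cong (mass (U c done) +_) dx)) ⟩
            mass (U c done) + δ + δ * countF (A c) ≡⟨ lem (mass (U c done)) δ (δ * countF (A c)) ⟩
            mass (U c done) + δ * countF (A c) + δ ≤⟨ +-monoˡ-≤ δ (balance st) ⟩
            mass (A c) + δ * countF (U c done) + δ ≡⟨ lem₂ (mass (A c)) δ (countF (U c done)) ⟩
            mass (A c) + δ * (countF (U c done) + 1)
              ≡⟨ cong (λ t → mass (A c) + δ * t) (count-update U-old U-new U-other) ⟨
            mass (A c) + δ * countF (U c done′) ∎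
            where
            open ≤-Reasoning
            lem : ∀ s d t → s + d + t ≡ s + t + d
            lem = solve-∀
            lem₂ : ∀ s d t → s + d * t + d ≡ s + d * (t + 1)
            lem₂ = solve-∀

        process-one : Σ (V → V) λ c′ → Stage c′ done′ δ
        process-one with exF (λ y → adj G x y ∧
          (Y y ∧ (⌊ size c (c y) <? k ⌋ ∧ ⌊ common r c (c x) (c y) ≤? b ⌋))) in eq
        ... | false = c , skip-one (λ y xy Yy room → ≰⇒> (λ few → exF-false eq y
                (∧-intro xy (∧-intro Yy (∧-intro (⌊⌋-true (size c (c y) <? k) room)
                  (⌊⌋-true (common r c (c x) (c y) ≤? b) few))))))
        ... | true with exF-elim eq
        ...   | y , e =
                merge c (c x) (c y) , attach-one (∧-fst {adj G x y} e) (∧-fst {Y y} e₁)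
                  (⌊⌋-elim (size c (c y) <? k) (∧-fst e₂))
                    (⌊⌋-elim (common r c (c x) (c y) ≤? b) (∧-snd {⌊ size c (c y) <? k ⌋} e₂))
          where
          e₁ = ∧-snd {adj G x y} e
          e₂ = ∧-snd {Y y} e₁

      -- `balance` is the subtraction-free form of: the sum of deg - δ over `U` is at most that over
      -- `A`. Lowering δ by one adds ∣U∣ on the left and ∣A∣ on the right, so `U≤A` preserves it.
      lower : ∀ {c done δ} → Stage c done (suc δ) → (∀ v → X v ≡ true → done v ≡ false → deg G v ≢ suc δ) →
        Stage c done δ
      lower {c} {done} {δ} st none = record
        { clus = clus st ; onY = onY st ; onX = onX st ; fresh = fresh st ; blocked = blocked st
        ; balance = +-cancelʳ-≤ (countF (A c)) _ _ (begin
            mass (U c done) + δ * countF (A c) + countF (A c) ≡⟨ lem (mass (U c done)) δ (countF (A c)) ⟩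
            mass (U c done) + suc δ * countF (A c) ≤⟨ balance st ⟩
            mass (A c) + suc δ * countF (U c done) ≡⟨ lem (mass (A c)) δ (countF (U c done)) ⟨
            mass (A c) + δ * countF (U c done) + countF (U c done) ≤⟨ +-monoʳ-≤ _ (U≤A st) ⟩
            mass (A c) + δ * countF (U c done) + countF (A c) ∎)
        ; top = λ v Xv e → s≤s⁻¹ (≤∧≢⇒< (top st v Xv e) (none v Xv e))
        }
        where
        open ≤-Reasoning
        lem : ∀ s d t → s + d * t + t ≡ s + (1 + d) * t
        lem = solve-∀

      waiting : (V → Bool) → V → Bool
      waiting done v = X v ∧ not (done v)

      -- Lexicographic recursion on δ and on the bound `f` for the number of waiting vertices.
      -- Waiting vertices have degree at most δ, so when none has degree exactly δ the threshold may
      -- drop; at δ = 0 none is waiting any more.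
      run : ∀ δ f c done → Stage c done δ → countF (waiting done) ≤ f →
            Σ (V → V) λ c → Σ (V → Bool) λ done → Stage c done 0 × (∀ v → X v ≡ true → done v ≡ true)
      run δ f c done st wf with exF (λ v → waiting done v ∧ ⌊ deg G v ≟ δ ⌋) in eq
      run zero f c done st wf | false = c , done , st , all-done
        where
        all-done : ∀ v → X v ≡ true → done v ≡ true
        all-done v Xv with done v in dv
        ... | true = refl
        ... | false =
                ⊥-elim (exF-false eq v (∧-intro (∧-intro Xv (not-false dv))
                  (⌊⌋-true (deg G v ≟ 0) (n≤0⇒n≡0 (top st v Xv dv)))))
      run (suc δ) f c done st wf | false =
        run δ (n G) c done (lower st (λ v Xv dv e → exF-false eq v
          (∧-intro (∧-intro Xv (not-false dv)) (⌊⌋-true (deg G v ≟ suc δ) e)))) (count≤n (waiting done))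
      run δ f c done st wf | true with exF-elim eq
      ... | x , ex = next f wf
        where
        w : waiting done x ≡ true
        w = ∧-fst ex
        Xx : X x ≡ true
        Xx = ∧-fst w
        dx : done x ≡ false
        dx = not-true (∧-snd {X x} w)
        fewer : countF (waiting done) ≡ countF (waiting (mark done x)) + 1
        fewer =
          count-update (trans (cong₂ (λ s t → s ∧ not t) Xx (mark-self done x)) refl) w
            (λ v ne → cong (λ z → X v ∧ not z) (sym (mark-other done ne)))
        next : ∀ f → countF (waiting done) ≤ f → Σ (V → V) λ c → Σ (V → Bool) λ done → Stage c done 0 ×
          (∀ v → X v ≡ true → done v ≡ true)
        next zero wf =
          ⊥-elim (n≮0 (≤-trans (≤-reflexive (trans (+-comm 1 (countF (waiting (mark done x)))) (sym fewer)))
            wf))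
        next (suc f) wf with process-one st Xx dx (⌊⌋-elim (deg G x ≟ δ) (∧-snd {waiting done x} ex))
        ... | c′ , st′ =
                run δ f c′ (mark done x) st′ (s≤s⁻¹
                  (≤-trans (≤-reflexive (trans (+-comm 1 (countF (waiting (mark done x)))) (sym fewer))) wf))

      -- No degree exceeds `n G`, so this is a safe first threshold. `A` and `U` are empty, so
      -- `balance` is trivial.
      initial : Stage s₀ (λ _ → false) (n G)
      initial = record
        { clus = record
          { idem = idem₀
          ; rooted = rooted₀
          ; bounded = bounded₀
          ; loss = +-monoʳ-≤ (Φ s₀) (*-monoʳ-≤ κ (count≤n (λ a → s₀ a == a)))
          }
        ; onY = λ _ → s₀-Y
        ; onX = λ _ Xv → inj₁ (s₀-X Xv)
        ; fresh = λ _ Xv _ → s₀-X Xv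
        ; blocked = λ { _ _ () _ }
        ; balance = ≤-trans (≤-reflexive (cong₂ _+_ mass≡0 (trans (cong (n G *_) count≡0) (*-zeroʳ (n G))))) z≤n
        ; top = λ v _ _ → count≤n (adj G v)
        }
        where
        idem₀ : Idempotent s₀
        idem₀ v with X⊎Y v
        ... | inj₁ Xv = cong s₀ (s₀-X Xv)
        ... | inj₂ Yv = trans (cong s₀ (s₀-Y Yv)) (trans (s₀-Y (Y-c₁ Yv)) (trans (idem cl₁ v) (sym (s₀-Y Yv))))
        rooted₀ : Rooted G s₀
        rooted₀ v with X⊎Y v
        ... | inj₁ Xv = subst (WalkIn G (λ u → s₀ u == s₀ v) v) (sym (s₀-X Xv)) (here (==-refl (s₀ v)))
        ... | inj₂ Yv =
                subst (λ a → WalkIn G (λ u → s₀ u == a) v a) (sym (s₀-Y Yv)) (walk-mono into (rooted cl₁ v))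
          where
          into : ∀ w → (c₁ w == c₁ v) ≡ true → (s₀ w == c₁ v) ≡ true
          into w e = trans (cong (_== c₁ v) (s₀-Y (trans (cong (λ a → not (light c₁ a)) (==⇒≡ e)) Yv))) e
        bounded₀ : ∀ a → size s₀ a ≤ k
        bounded₀ a with X⊎Y a
        ... | inj₂ Ya = ≤-trans (count-mono {q = λ v → c₁ v == a} into) (≤-trans (bounded cl₁ a) 2h≤k)
          where
          into : ∀ v → (s₀ v == a) ≡ true → (c₁ v == a) ≡ true
          into v e with X⊎Y v
          ... | inj₁ Xv = ⊥-elim (X⇒¬Y Xv (subst (λ z → Y z ≡ true) (trans (sym (==⇒≡ e)) (s₀-X Xv)) Ya))
          ... | inj₂ Yv = trans (cong (_== a) (sym (s₀-Y Yv))) e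
        ... | inj₁ Xa =
                ≤-trans (count-mono {q = λ v → v == a} into)
                  (≤-trans (≤-reflexive (size-id a)) (≤-trans h>0 (≤-trans (m≤m+n h _) 2h≤k)))
          where
          into : ∀ v → (s₀ v == a) ≡ true → (v == a) ≡ true
          into v e with X⊎Y v
          ... | inj₁ Xv = trans (cong (_== a) (sym (s₀-X Xv))) e
          ... | inj₂ Yv = ⊥-elim (X⇒¬Y Xa (subst (λ z → Y z ≡ true) (trans (sym (s₀-Y Yv)) (==⇒≡ e)) (Y-c₁ Yv)))
        U-empty : ∀ v → U s₀ (λ _ → false) v ≡ false
        U-empty v with X v
        ... | true = refl
        ... | false = refl
        A-empty : ∀ v → A s₀ v ≡ false
        A-empty v with X⊎Y v
        ... | inj₁ Xv = trans (cong₂ (λ s t → s ∧ not (t == v)) Xv (s₀-X Xv)) (cong not (==-refl v))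
        ... | inj₂ Yv = cong (_∧ not (s₀ v == v)) (not-true Yv)
        mass≡0 : mass (U s₀ (λ _ → false)) ≡ 0
        mass≡0 = trans (sum-cong (λ v → cong (λ z → ι z * deg G v) (U-empty v))) (sum-zero (n G))
        count≡0 : countF (A s₀) ≡ 0
        count≡0 = trans (count≡sum (A s₀)) (trans (sum-cong (λ v → ι-false (A-empty v))) (sum-zero (n G)))

      -- Counting the vertices and edges of the contracted graph.

      big : V → Bool
      big v = ⌊ B <? deg G v ⌋

      big-bound : countF big * (1 + B) ≤ degsum r
      big-bound = begin
        countF big * (1 + B) ≡⟨ trans (cong (_* (1 + B)) (count≡sum big)) (*-comm _ (1 + B)) ⟩
        (1 + B) * sumF (ι ∘ big) ≡⟨ sum-* (1 + B) (ι ∘ big) ⟨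
        sumF (λ v → (1 + B) * ι (big v))
          ≤⟨ sum-mono (λ v → ≤-trans (≤-reflexive (*-comm (1 + B) (ι (big v))))
            (ι*-bound (big v) (λ e → ≤-trans (⌊⌋-elim (B <? deg G v) e) (≤-reflexive (deg≡ G v))))) ⟩
        degsum r ∎
        where open ≤-Reasoning

      total-weight : sumF wt ≤ n G + (1 + h) * countF big
      total-weight = begin
        sumF wt ≤⟨ sum-mono pt ⟩
        sumF (λ v → 1 + (1 + h) * ι (big v)) ≡⟨ sum-+ (λ _ → 1) (λ v → (1 + h) * ι (big v)) ⟩
        sumF {n G} (λ _ → 1) + sumF (λ v → (1 + h) * ι (big v))
          ≡⟨ cong₂ _+_ (trans (sum-const {n G} 1) (*-identityʳ (n G)))
            (trans (sum-* (1 + h) (ι ∘ big)) (cong ((1 + h) *_) (sym (count≡sum big)))) ⟩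
        n G + (1 + h) * countF big ∎
        where
        open ≤-Reasoning
        pt : ∀ v → wt v ≤ 1 + (1 + h) * ι (big v)
        pt v with ⌊ B <? deg G v ⌋
        ... | true = ≤-trans (≤-reflexive (sym (*-identityʳ (1 + h)))) (n≤1+n _)
        ... | false = s≤s z≤n

      -- In `mass X` an edge between `X` and `Y` counts once and an edge inside `X` twice. So
      -- `2 * mass X` exceeds `degsum r` by at most the number of ordered adjacent pairs inside `X`,
      -- which `few-X` bounds.
      mass-X : 2 * mass X ≤ degsum r + n G * (h + m)
      mass-X = begin
        2 * mass X ≡⟨ cong (mass X +_) (+-identityʳ (mass X)) ⟩
        mass X + mass X ≡⟨ cong₂ _+_ eq (trans eq (sum-swap (λ u v → ι (X u) * ι (r u v)))) ⟩
        sumF (λ u → sumF (λ v → ι (X u) * ι (r u v))) + sumF (λ u → sumF (λ v → ι (X v) * ι (r v u)))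
          ≡⟨ trans (sym (sum-+ (λ u → sumF (λ v → ι (X u) * ι (r u v)))
            (λ u → sumF (λ v → ι (X v) * ι (r v u)))))
              (sum-cong (λ u → sym (sum-+ (λ v → ι (X u) * ι (r u v)) (λ v → ι (X v) * ι (r v u))))) ⟩
        sumF (λ u → sumF (λ v → ι (X u) * ι (r u v) + ι (X v) * ι (r v u)))
          ≤⟨ sum-mono (λ u → sum-mono (λ v → ≤-trans
            (≤-reflexive (cong (λ z → ι (X u) * ι (r u v) + ι (X v) * ι z) (Graph.sym G v u)))
              (pt (X u) (X v) (r u v)))) ⟩
        sumF (λ u → sumF (λ v → ι (r u v) + ι (X u) * ι (r u v ∧ X v)))
          ≡⟨ trans (sum-cong (λ u → trans (sum-+ (λ v → ι (r u v)) (λ v → ι (X u) * ι (r u v ∧ X v)))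
            (cong (sumF (λ v → ι (r u v)) +_)
              (trans (sum-* (ι (X u)) (λ v → ι (r u v ∧ X v)))
                (cong (ι (X u) *_) (sym (count≡sum (λ v → r u v ∧ X v))))))))
                  (sum-+ (λ u → sumF (λ v → ι (r u v))) (λ u → ι (X u) * countF (λ v → r u v ∧ X v))) ⟩
        degsum r + sumF (λ u → ι (X u) * countF (λ v → r u v ∧ X v))
          ≤⟨ +-monoʳ-≤ (degsum r) (sum-mono (λ u → ι*-bound (X u) (few-X u))) ⟩
        degsum r + sumF {n G} (λ _ → h + m) ≡⟨ cong (degsum r +_) (sum-const {n G} (h + m)) ⟩
        degsum r + n G * (h + m) ∎
        where
        open ≤-Reasoning
        eq : mass X ≡ sumF (λ u → sumF (λ v → ι (X u) * ι (r u v)))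
        eq = sum-cong (λ u → trans (cong (ι (X u) *_) (deg≡ G u)) (sym (sum-* (ι (X u)) (λ v → ι (r u v)))))
        pt : ∀ s t a → ι s * ι a + ι t * ι a ≤ ι a + ι s * ι (a ∧ t)
        pt false true a = ≤-refl
        pt false false a = z≤n
        pt true false a = +-mono-≤ (≤-reflexive (+-identityʳ (ι a))) z≤n
        pt true true true = ≤-refl
        pt true true false = z≤n

      module Result {c done} (st : Stage c done 0) (all-done : ∀ v → X v ≡ true → done v ≡ true) where
        q = quot r c

        root : V → Bool
        root a = Y a ∧ (c a == a)

        M : Graph
        M = sub root q (quot-sym c (Graph.sym G)) (quot-irr c)

        minor : BoundedMinor k M G
        minor = record
          { branch = λ i v → c v == enum root i
          ; nonempty = λ i → enum root i , ∧-snd {Y (enum root i)} (enum-true root i)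
          ; disjoint = λ i j v i≢j ei ej → i≢j (enum-inj root (trans (sym (==⇒≡ ei)) (==⇒≡ ej)))
          ; connected = λ i → rooted⇒connected G c (rooted (clus st)) (enum root i)
          ; small = λ i → bounded (clus st) (enum root i)
          ; realise = realise′
          }
          where
          realise′ : ∀ i j → q (enum root i) (enum root j) ≡ true →
                     ∃ λ u → ∃ λ v → (c u == enum root i) ≡ true × (c v == enum root j) ≡ true × adj G u v ≡
                       true
          realise′ i j e with quot-elim c e
          ... | _ , u , v , cu , cv , uv =
                  u , v , trans (cong (_== enum root i) cu) (==-refl _) , trans (cong (_== enum root j) cv)
                    (==-refl _) , uv

        -- A final class with a root contains the class of that root under `c₁`. That class is not
        -- light, so it weighs at least `1 + h`; the classes of `c₁` are disjoint, so together they
        -- weigh at most `sumF wt`.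
        few-roots : (1 + h) * countF root ≤ n G + (1 + h) * countF big
        few-roots = ≤-trans (begin
          (1 + h) * countF root ≡⟨ trans (cong ((1 + h) *_) (count≡sum root)) (sym (sum-* (1 + h) (ι ∘ root))) ⟩
          sumF (λ a → (1 + h) * ι (root a))
            ≤⟨ sum-mono (λ a → ≤-trans (≤-reflexive (*-comm (1 + h) (ι (root a))))
              (ι*-bound (root a) (heavy a))) ⟩
          sumF (λ a → weight c₁ a) ≡⟨ sum-fiber c₁ wt ⟩
          sumF wt ∎) total-weight
          where
          open ≤-Reasoning
          heavy : ∀ a → root a ≡ true → 1 + h ≤ weight c₁ a
          heavy a e = subst (λ z → 1 + h ≤ weight c₁ z) (trans (sym (onY st a Ya)) (==⇒≡ (∧-snd {Y a} e)))
            (≰⇒> (⌊⌋-false (weight c₁ (c₁ a) ≤? h) (not-true Ya)))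
            where
            Ya : Y a ≡ true
            Ya = ∧-fst e

        U-heavier : mass (U c done) ≤ mass (A c)
        U-heavier =
          ≤-trans (≤-reflexive (sym (+-identityʳ _))) (≤-trans (balance st) (≤-reflexive (+-identityʳ _)))

        -- `U` and `A` are disjoint subsets of `X`, and `U` is the one of smaller degree sum.
        mass-U : 2 * mass (U c done) ≤ mass X
        mass-U = begin
          2 * mass (U c done) ≡⟨ cong (mass (U c done) +_) (+-identityʳ _) ⟩
          mass (U c done) + mass (U c done) ≤⟨ +-monoʳ-≤ _ U-heavier ⟩
          mass (U c done) + mass (A c) ≡⟨ sum-+ (λ v → ι (U c done v) * deg G v) (λ v → ι (A c v) * deg G v) ⟨
          sumF (λ v → ι (U c done v) * deg G v + ι (A c v) * deg G v)
            ≤⟨ sum-mono (λ v → ≤-trans (≤-reflexive (sym (*-distribʳ-+ (deg G v) (ι (U c done v)) (ι (A c v)))))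
              (*-monoˡ-≤ (deg G v) (pt (X v) (done v) (c v == v)))) ⟩
          mass X ∎
          where
          open ≤-Reasoning
          pt : ∀ s t e → ι (s ∧ (t ∧ e)) + ι (s ∧ not e) ≤ ι s
          pt false t e = z≤n
          pt true true true = ≤-refl
          pt true true false = ≤-refl
          pt true false true = z≤n
          pt true false false = ≤-refl

        deleted : sumF (λ a → ι (not (root a)) * sumF (λ b → ι (q a b))) ≤ mass (U c done)
        deleted = sum-mono pt
          where
          pt : ∀ a → ι (not (root a)) * sumF (λ b → ι (q a b)) ≤ ι (U c done a) * deg G a
          pt a = cases (c a F.≟ a) (X⊎Y a)
            where
            open ≤-Reasoning
            cases : Dec (c a ≡ a) → X a ≡ true ⊎ Y a ≡ true → ι (not (root a)) * sumF (λ b → ι (q a b)) ≤ ι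
              (U c done a) * deg G a
            cases (yes ca) (inj₂ Ya) rewrite ∧-intro Ya (trans (cong (_== a) ca) (==-refl a)) = z≤n
            cases (no ca≢a) _ = begin
              ι (not (root a)) * sumF (λ b → ι (q a b)) ≤⟨ ι*-≤-self (not (root a)) _ ⟩
              sumF (λ b → ι (q a b)) ≤⟨ quot-degree G c a ⟩
              sumF (λ u → ι (c u == a) * deg G u)
                ≡⟨ sum-cong (λ u → cong (λ z → ι z * deg G u)
                  (≢⇒== (λ cu → ca≢a (trans (cong c (sym cu)) (trans (idem (clus st) u) cu))))) ⟩
              sumF {n G} (λ _ → 0) ≡⟨ sum-zero (n G) ⟩
              0 ≤⟨ z≤n ⟩
              ι (U c done a) * deg G a ∎
            cases (yes ca) (inj₁ Xa) = begin
              ι (not (root a)) * sumF (λ b → ι (q a b)) ≤⟨ ι*-≤-self (not (root a)) _ ⟩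
              sumF (λ b → ι (q a b)) ≤⟨ quot-degree G c a ⟩
              sumF (λ u → ι (c u == a) * deg G u)
                ≤⟨ sum-mono (λ u → *-monoˡ-≤ (deg G u)
                  (ι-mono (λ e → trans (cong (a ==_) (single st Xa (==⇒≡ e))) (==-refl a)))) ⟩
              sumF (λ u → ι (a == u) * deg G u) ≡⟨ sum-delta a (deg G) ⟩
              deg G a
                ≡⟨ trans (cong (_* deg G a) (ι-true {U c done a}
                  (∧-intro Xa (∧-intro (all-done a Xa) (trans (cong (_== a) ca) (==-refl a)))))) (+-identityʳ _)
                    ⟨
              ι (U c done a) * deg G a ∎

        -- Deleting `U` costs `2 * mass U`, and four times `mass U` is at most
        -- `degsum r + n G * (h + m)`. The estimate is therefore doubled, after which one copy of
        -- `degsum r` cancels.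
        many-edges : degsum r ≤ 4 * edges M + n G * (h + m + 4 * κ)
        many-edges = +-cancelˡ-≤ (degsum r) _ _ (begin
          degsum r + degsum r ≤⟨ +-mono-≤ E≤ E≤ ⟩
          (Φ c + 2 * κ * n G) + (Φ c + 2 * κ * n G) ≤⟨ +-mono-≤ (+-monoˡ-≤ _ Φ≤) (+-monoˡ-≤ _ Φ≤) ⟩
          (2 * edges M + 2 * mass (U c done) + 2 * κ * n G) + (2 * edges M + 2 * mass (U c done) + 2 * κ * n G)
            ≡⟨ lem (edges M) (mass (U c done)) κ (n G) ⟩
          4 * edges M + 2 * (2 * mass (U c done)) + 4 * κ * n G
            ≤⟨ +-monoˡ-≤ _ (+-monoʳ-≤ (4 * edges M) (≤-trans (*-monoʳ-≤ 2 mass-U) mass-X)) ⟩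
          4 * edges M + (degsum r + n G * (h + m)) + 4 * κ * n G ≡⟨ lem₂ (edges M) (degsum r) (n G) (h + m) κ ⟩
          degsum r + (4 * edges M + n G * (h + m + 4 * κ)) ∎)
          where
          open ≤-Reasoning
          lem : ∀ e u k n → (2 * e + 2 * u + 2 * k * n) + (2 * e + 2 * u + 2 * k * n) ≡ 4 * e + 2 * (2 * u) + 4
            * k * n
          lem = solve-∀
          lem₂ : ∀ e d n g k → 4 * e + (d + n * g) + 4 * k * n ≡ d + (4 * e + n * (g + 4 * k))
          lem₂ = solve-∀
          Φ≤ : Φ c ≤ 2 * edges M + 2 * mass (U c done)
          Φ≤ = begin
            Φ c ≤⟨ degsum-on root q (quot-sym c (Graph.sym G)) ⟩
            degsum (on root q) + 2 * sumF (λ a → ι (not (root a)) * sumF (λ b → ι (q a b)))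
              ≤⟨ +-mono-≤ (≤-reflexive (sym (2edges-sub root q (quot-sym c (Graph.sym G)) (quot-irr c))))
                (*-monoʳ-≤ 2 deleted) ⟩
            2 * edges M + 2 * mass (U c done) ∎
          E≤ : degsum r ≤ Φ c + 2 * κ * n G
          E≤ = begin
            degsum r ≤⟨ m≤m+n _ _ ⟩
            degsum r + κ * classes c₁ ≤⟨ loss cl₁ ⟩
            -- Dissolving the light classes only refines the labelling, so it loses no edges of the
            -- quotient. The two rounds of contraction are charged separately, at most `κ * n G`
            -- each.
            Φ c₁ + κ * n G ≤⟨ +-monoˡ-≤ (κ * n G) (≤-trans (quot-refine r c₁ s₀ c₁ refines) (m≤m+n _ _)) ⟩
            Φ s₀ + κ * classes c + κ * n G ≤⟨ +-monoˡ-≤ (κ * n G) (loss (clus st)) ⟩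
            Φ c + κ * n G + κ * n G ≡⟨ lem₃ (Φ c) κ (n G) ⟩
            Φ c + 2 * κ * n G ∎
            where
            lem₃ : ∀ p k n → p + k * n + k * n ≡ p + 2 * k * n
            lem₃ = solve-∀
            refines : ∀ v → c₁ v ≡ c₁ (s₀ v)
            refines v with X⊎Y v
            ... | inj₁ Xv = cong c₁ (sym (s₀-X Xv))
            ... | inj₂ Yv = trans (sym (idem cl₁ v)) (cong c₁ (sym (s₀-Y Yv)))

    dense-minor : Σ Graph λ M → BoundedMinor k M G × degsum r ≤ 4 * edges M + n G * (h + m + 4 * κ) ×
      ∃ λ t → (1 + h) * n M ≤ n G + (1 + h) * t × t * (1 + B) ≤ degsum r
    dense-minor with grow (n G) (λ v → v) (count≤n (λ (a : V) → a == a)) discrete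
    ... | c₁ , cl₁ , stuck with Attach.run c₁ cl₁ stuck (n G) (n G) _ _ (Attach.initial c₁ cl₁ stuck)
      (count≤n (Attach.waiting c₁ cl₁ stuck (λ _ → false)))
    ...   | c , done , st , all-done = M , minor , many-edges , countF big , few-roots , big-bound
      where
      open Attach c₁ cl₁ stuck
      open Result st all-done

  -- The three alternatives over the natural numbers

  minor-of-subgraph : ∀ {k M H G} → SubgraphOf H G → BoundedMinor k M H → BoundedMinor k M G
  minor-of-subgraph {k} {M} {H} {G} s μ = record
    { branch = image
    ; nonempty = λ a → emb s (proj₁ (nonempty μ a)) , in-image a (proj₂ (nonempty μ a))
    ; disjoint = disjoint′
    ; connected = connected′
    ; small = λ a → ≤-trans (count-image a) (small μ a)
    ; realise = realise′
    }
    where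
    image : Fin (n M) → Fin (n G) → Bool
    image a v = exF (λ u → (emb s u == v) ∧ branch μ a u)
    in-image : ∀ a {u} → branch μ a u ≡ true → image a (emb s u) ≡ true
    in-image a {u} e = exF-intro u (∧-intro (==-refl (emb s u)) e)
    from-image : ∀ {a v} → image a v ≡ true → ∃ λ u → emb s u ≡ v × branch μ a u ≡ true
    from-image {v = v} e with exF-elim e
    ... | u , eu = u , ==⇒≡ (∧-fst eu) , ∧-snd {emb s u == v} eu
    disjoint′ : ∀ a b v → a ≢ b → image a v ≡ true → image b v ≡ true → ⊥
    disjoint′ a b v a≢b ea eb with from-image ea | from-image eb
    ... | u , refl , au | u′ , e , bu′ =
            disjoint μ a b u a≢b au (subst (λ z → branch μ b z ≡ true) (inj s e) bu′)
    walk : ∀ {a u v} → WalkIn H (branch μ a) u v → WalkIn G (image a) (emb s u) (emb s v)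
    walk {a} (here e) = here (in-image a e)
    walk {a} (step e uw p) = step (in-image a e) (presAdj s _ _ uw) (walk p)
    connected′ : ∀ a → Connected G (image a)
    connected′ a u v eu ev with from-image eu | from-image ev
    ... | u′ , refl , au | v′ , refl , av = walk (connected μ a u′ v′ au av)
    count-image : ∀ a → countF (image a) ≤ countF (branch μ a)
    count-image a = begin
      countF (image a) ≡⟨ count≡sum (image a) ⟩
      sumF (λ v → ι (image a v)) ≡⟨ sum-cong (λ v → sym (+-identityʳ (ι (image a v)))) ⟩
      sumF (λ v → 1 * ι (image a v)) ≤⟨ sum-image (emb s) (branch μ a) (λ _ → 1) ⟩
      sumF (λ u → 1 * ι (branch μ a u)) ≡⟨ sum-cong (λ u → +-identityʳ (ι (branch μ a u))) ⟩
      sumF (λ u → ι (branch μ a u)) ≡⟨ count≡sum (branch μ a) ⟨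
      countF (branch μ a) ∎
      where open ≤-Reasoning
    realise′ : ∀ a b → adj M a b ≡ true → ∃ λ u → ∃ λ v → image a u ≡ true × image b v ≡ true × adj G u v ≡ true
    realise′ a b ab with realise μ a b ab
    ... | u , v , au , bv , uv = emb s u , emb s v , in-image a au , in-image b bv , presAdj s u v uv

  minor-refl : ∀ {k} → 1 ≤ k → ∀ G → BoundedMinor k G G
  minor-refl 1≤k G = record
    { branch = λ a v → v == a
    ; nonempty = λ a → a , ==-refl a
    ; disjoint = λ a b v a≢b ea eb → a≢b (trans (sym (==⇒≡ ea)) (==⇒≡ eb))
    ; connected = λ a → rooted⇒connected G (λ v → v) (λ v → here (==-refl v)) a
    ; small = λ a → ≤-trans (≤-reflexive (size-id a)) 1≤k
    ; realise = λ a b ab → a , b , ==-refl a , ==-refl b , ab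
    }

  -- The bipartite subgraph between two disjoint sets of vertices.

  module _ (G : Graph) (X Y : Fin (n G) → Bool) (X∩Y : ∀ v → X v ≡ true → Y v ≡ false) where
    private
      p : Fin (n G) → Bool
      p v = X v ∨ Y v
      r : Fin (n G) → Fin (n G) → Bool
      r u v = adj G u v ∧ (X u xor X v)
      r-sym : ∀ u v → r u v ≡ r v u
      r-sym u v = cong₂ _∧_ (Graph.sym G u v) (Bool.xor-comm (X u) (X v))
      r-irr : ∀ v → r v v ≡ false
      r-irr v = cong (_∧ (X v xor X v)) (irref G v)

    crossing : Graph
    crossing = sub p r r-sym r-irr

    crossing⊆ : SubgraphOf crossing G
    crossing⊆ = sub⊆ G p r r-sym r-irr (λ u v → ∧-fst)

    left : Fin (n crossing) → Bool
    left i = X (enum p i)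

    crossing-bipartite : ∀ i j → adj crossing i j ≡ true → left i ≡ true → left j ≡ false
    crossing-bipartite i j e Xi with X (enum p i) | X (enum p j) | ∧-snd {adj G (enum p i) (enum p j)} e
    ... | true | false | _ = refl

    left-count : countF X ≤ countF left
    left-count = ≤-trans (count-mono (λ v e → ∧-intro (cong (_∨ Y v) e) e)) (≤-reflexive (sym (count-enum p X)))

    right-count : countF (λ i → not (left i)) ≤ countF Y
    right-count = ≤-trans (≤-reflexive (count-enum p (not ∘ X))) (count-mono (λ v → pt (X v) (Y v)))
      where
      pt : ∀ s t → (s ∨ t) ∧ not s ≡ true → t ≡ true
      pt false true _ = refl

    crossing-degree : ∀ i → left i ≡ true →
      countF (λ y → adj G (enum p i) y ∧ Y y) ≤ countF (λ j → adj crossing i j ∧ not (left j))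
    crossing-degree i Xi =
      ≤-trans (count-mono into) (≤-reflexive (sym (count-enum p (λ v → r (enum p i) v ∧ not (X v)))))
      where
      into : ∀ v → adj G (enum p i) v ∧ Y v ≡ true → p v ∧ (r (enum p i) v ∧ not (X v)) ≡ true
      into v e = cases (X v) refl
        where
        cases : ∀ t → X v ≡ t → (X v ∨ Y v) ∧ ((adj G (enum p i) v ∧ (X (enum p i) xor X v)) ∧ not (X v)) ≡ true
        cases true Xv = ⊥-elim (true≢false (∧-snd {adj G (enum p i) v} e) (X∩Y v Xv))
        cases false Xv rewrite Xv | Xi =
          ∧-intro (∧-snd {adj G (enum p i) v} e) (∧-intro (∧-intro (∧-fst e) refl) refl)

  -- With ε = p/q and d = e/N, all inequalities are multiplied out; u/w is εd, and θ/q is 1 − 2kε.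
  module Scaled (k ℓ p q : ℕ) (2≤ℓ : 2 ≤ ℓ) (ℓ≤k : ℓ ≤ k) (4kp<q : 4 * k * p < q)
    (G : Graph) (0<N : 0 < n G) where

    N = n G
    e = edges G
    u = p * e
    w = q * N
    θ = q ∸ 2 * k * p

    DenseSpot : Set
    DenseSpot = Σ Graph λ H → SubgraphOf H G × n H * N ≤ 3 * (k * k * k) * e × u * u ≤ 2 * edges H * (w * w)

    Unbalanced : Set
    Unbalanced = Σ Graph λ H → SubgraphOf H G × Σ (Fin (n H) → Bool) λ inX →
      (∀ u v → adj H u v ≡ true → inX u ≡ true → inX v ≡ false) ×
      (ℓ * countF (λ v → not (inX v)) < countF inX) ×
      (∀ x → inX x ≡ true → θ * e ≤ countF (λ y → adj H x y ∧ not (inX y)) * w)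

    DenseMinor : Set
    DenseMinor = Σ Graph λ M → BoundedMinor k M G × 0 < n M × k * θ * e * n M ≤ edges M * (8 * ℓ * w)

    module _ (w≤u : w ≤ u) where

      0<q : 0 < q
      0<q = ≤-trans (s≤s z≤n) 4kp<q

      0<w : 0 < w
      0<w = *-mono-≤ 0<q 0<N

      0<u : 0 < u
      0<u = ≤-trans 0<w w≤u

      -- Here the factor k/(8ℓ) is at most 1, so the graph itself is dense enough. Afterwards k > 8ℓ
      -- ≥ 16, which makes `h` positive and leaves room for the additive constants below.
      trivial-case : k ≤ 8 * ℓ → DenseMinor
      trivial-case k≤8ℓ = G , minor-refl (≤-trans (≤-trans (s≤s z≤n) 2≤ℓ) ℓ≤k) G , 0<N , (begin
        k * θ * e * N ≤⟨ *-monoˡ-≤ N (*-monoˡ-≤ e (*-mono-≤ k≤8ℓ (m∸n≤m q (2 * k * p)))) ⟩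
        8 * ℓ * q * e * N ≡⟨ lem ℓ q e N ⟩
        e * (8 * ℓ * w) ∎)
        where
        open ≤-Reasoning
        lem : ∀ ℓ q e N → 8 * ℓ * q * e * N ≡ e * (8 * ℓ * (q * N))
        lem = solve-∀

      module _ (k>8ℓ : 8 * ℓ < k) (G₀ : Graph) (G₀⊆G : SubgraphOf G₀ G) (dense₀ : e * n G₀ ≤ edges G₀ * N)
        (0<n₀ : 0 < n G₀) (min-deg : ∀ v → e ≤ deg G₀ v * N) where

        private
          V = Fin (n G₀)
          instance
            N≢0 : NonZero N
            N≢0 = >-nonZero 0<N
            w≢0 : NonZero w
            w≢0 = >-nonZero 0<w
            u≢0 : NonZero u
            u≢0 = >-nonZero 0<u
            4w≢0 : NonZero (4 * w)
            4w≢0 = >-nonZero (≤-trans 0<w (m≤m+n w _))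

          16≤k : 16 ≤ k
          16≤k = ≤-trans (*-monoʳ-≤ 8 2≤ℓ) (<⇒≤ k>8ℓ)

          -- Up to rounding down, `B` is kd, `b` is kεd/4 and `m` is 4εd. The choice of `b` trades
          -- the cost of a contraction against the number of bad neighbours: a set with fewer than
          -- (εd)² ordered adjacent pairs leaves room for fewer than 4εd/k bad classes, each of at
          -- most k vertices.
          h B b m : ℕ
          h = k / ((1 + ℓ) * 2)
          B = k * e / N
          b = k * u / (4 * w)
          m = 4 * u / w

          ≤[1+/] : ∀ a d .{{_ : NonZero d}} → a ≤ (1 + a / d) * d
          ≤[1+/] a d = ≤-trans (≤-reflexive (m≡m%n+[m/n]*n a d)) (+-monoˡ-≤ _ (<⇒≤ (m%n<n a d)))

          cap : (1 + ℓ) * (2 * h) ≤ k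
          cap = ≤-trans (≤-reflexive (trans (sym (*-assoc (1 + ℓ) 2 h)) (*-comm _ h))) (m/n*n≤m k ((1 + ℓ) * 2))

          h>0 : 1 ≤ h
          h>0 = m≥n⇒m/n>0 (begin
            (1 + ℓ) * 2 ≤⟨ *-monoˡ-≤ 2 (+-monoˡ-≤ ℓ (≤-trans (s≤s z≤n) 2≤ℓ)) ⟩
            (ℓ + ℓ) * 2 ≡⟨ lem ℓ ⟩
            4 * ℓ ≤⟨ *-monoˡ-≤ ℓ {4} {8} (s≤s (s≤s (s≤s (s≤s z≤n)))) ⟩
            8 * ℓ ≤⟨ <⇒≤ k>8ℓ ⟩
            k ∎)
            where
            open ≤-Reasoning
            lem : ∀ ℓ → (ℓ + ℓ) * 2 ≡ 4 * ℓ
            lem = solve-∀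

          h≤k : h ≤ k
          h≤k = m/n≤m k ((1 + ℓ) * 2)

          mw≤4u : m * w ≤ 4 * u
          mw≤4u = m/n*n≤m (4 * u) w

          -- Alternative (i) for an induced subgraph. Quantifying over vertex sets instead of graphs
          -- makes the alternatives (i) and (ii) decidable by exhaustion, so their failure can be
          -- assumed constructively.
          P₁ : (V → Bool) → Set
          P₁ T = countF T * N ≤ 3 * (k * k * k) * e × u * u ≤ degsum (on T (adj G₀)) * (w * w)

          P₂ : (V → Bool) → (V → Bool) → Set
          P₂ X Y = (∀ v → X v ∧ Y v ≡ false) × ℓ * countF Y < countF X ×
                   (∀ x → X x ≡ true → θ * e ≤ countF (λ y → adj G₀ x y ∧ Y y) * w)

          P₁⇒DenseSpot : ∀ T → P₁ T → DenseSpot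
          P₁⇒DenseSpot T (T≤ , dense) = sub T (adj G₀) (Graph.sym G₀) (irref G₀)
            , SubgraphOf-trans (sub⊆ G₀ T (adj G₀) (Graph.sym G₀) (irref G₀) (λ _ _ r → r)) G₀⊆G
            , T≤ , ≤-trans dense (≤-reflexive
              (cong (_* (w * w)) (sym (2edges-sub T (adj G₀) (Graph.sym G₀) (irref G₀)))))

          P₂⇒Unbalanced : ∀ X Y → P₂ X Y → Unbalanced
          P₂⇒Unbalanced X Y (disj , many , high) = crossing G₀ X Y X∩Y
            , SubgraphOf-trans (crossing⊆ G₀ X Y X∩Y) G₀⊆G
            , left G₀ X Y X∩Y
            , crossing-bipartite G₀ X Y X∩Y
            , ≤-trans (s≤s (*-monoʳ-≤ ℓ (right-count G₀ X Y X∩Y))) (≤-trans many (left-count G₀ X Y X∩Y))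
            , λ i Xi → ≤-trans (high _ Xi) (*-monoˡ-≤ w (crossing-degree G₀ X Y X∩Y i Xi))
            where
            X∩Y : ∀ v → X v ≡ true → Y v ≡ false
            X∩Y v Xv = trans (cong (_∧ Y v) (sym Xv)) (disj v)

          P₁? : (T : Subset (n G₀)) → Dec (P₁ (lookup T))
          P₁? T = (_ ≤? _) ×-dec (_ ≤? _)

          P₂? : (X Y : Subset (n G₀)) → Dec (P₂ (lookup X) (lookup Y))
          P₂? X Y = F.all? (λ v → (lookup X v ∧ lookup Y v) Bool.≟ false) ×-dec ((_ <? _) ×-dec
                    F.all? (λ x → (lookup X x Bool.≟ true) →-dec (_ ≤? _)))

          -- The exhaustive search runs over bit vectors. A predicate agrees only pointwise with its
          -- tabulation, so invariance under pointwise equality has to be proved.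
          P₁-cong : ∀ {T T′} → (∀ v → T v ≡ T′ v) → P₁ T → P₁ T′
          P₁-cong eq (T≤ , dense) = subst (λ z → z * N ≤ _) (count-cong eq) T≤
            , subst (λ z → u * u ≤ z * (w * w))
              (sum-cong (λ a → sum-cong (λ b → cong₂ (λ s t → ι (s ∧ (t ∧ adj G₀ a b))) (eq a) (eq b)))) dense

          P₂-cong : ∀ {X X′ Y Y′} → (∀ v → X v ≡ X′ v) → (∀ v → Y v ≡ Y′ v) → P₂ X Y → P₂ X′ Y′
          P₂-cong eqX eqY (disj , many , high) =
              (λ v → trans (cong₂ _∧_ (sym (eqX v)) (sym (eqY v))) (disj v))
            , subst₂ (λ s t → ℓ * s < t) (count-cong eqY) (count-cong eqX) many
            , λ x Xx → subst (λ z → θ * e ≤ z * w) (count-cong (λ y → cong (adj G₀ x y ∧_) (eqY y)))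
              (high x (trans (eqX x) Xx))

          module _ (¬P₁ : ∀ T → ¬ P₁ T) (¬P₂ : ∀ X Y → ¬ P₂ X Y) where
            open ≤-Reasoning

            -- The set has at most (k² + k)`B` ≤ 3k³d vertices, so by the failure of (i) it spans
            -- fewer than (εd)² ordered pairs. Since 1 + `b` ≥ kεd/4, this gives kt ≤ 4εd.
            sparse : ∀ (T : V → Bool) t → countF T ≤ k * (k * B) + k * B →
                     t * (1 + b) ≤ degsum (on T (adj G₀)) → k * t ≤ m
            sparse T t T≤ dense = ≤-trans (≤-reflexive (sym (m*n/n≡m (k * t) w))) (/-monoˡ-≤ w ktw≤4u)
              where
              T≤′ : countF T * N ≤ 3 * (k * k * k) * e
              T≤′ = begin
                countF T * N ≤⟨ *-monoˡ-≤ N T≤ ⟩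
                (k * (k * B) + k * B) * N ≡⟨ lem k B N ⟩
                (k * k + k) * (B * N)
                  ≤⟨ *-mono-≤ (+-monoʳ-≤ (k * k) (≤-trans
                    (≤-trans (≤-reflexive (sym (*-identityʳ k))) (*-monoʳ-≤ k (≤-trans (s≤s z≤n) 16≤k)))
                      (m≤m+n (k * k) (k * k)))) (m/n*n≤m (k * e) N) ⟩
                (k * k + (k * k + k * k)) * (k * e) ≡⟨ lem₂ k e ⟩
                3 * (k * k * k) * e ∎
                where
                lem : ∀ k B N → (k * (k * B) + k * B) * N ≡ (k * k + k) * (B * N)
                lem = solve-∀
                lem₂ : ∀ k e → (k * k + (k * k + k * k)) * (k * e) ≡ 3 * (k * k * k) * e
                lem₂ = solve-∀
              few : t * (1 + b) * (w * w) ≤ u * u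
              few = ≤-trans (*-monoˡ-≤ (w * w) dense) (<⇒≤ (≰⇒> (λ ge → ¬P₁ T (T≤′ , ge))))
              ktw≤4u : k * t * w ≤ 4 * u
              ktw≤4u = *-cancelʳ-≤ (k * t * w) (4 * u) u (begin
                k * t * w * u ≡⟨ lem k t w u ⟩
                t * w * (k * u) ≤⟨ *-monoʳ-≤ (t * w) (≤[1+/] (k * u) (4 * w)) ⟩
                t * w * ((1 + b) * (4 * w)) ≡⟨ lem₂ t w b ⟩
                4 * (t * (1 + b) * (w * w)) ≤⟨ *-monoʳ-≤ 4 few ⟩
                4 * (u * u) ≡⟨ *-assoc 4 u u ⟨
                4 * u * u ∎)
                where
                lem : ∀ k t w u → k * t * w * u ≡ t * w * (k * u)
                lem = solve-∀
                lem₂ : ∀ t w b → t * w * ((1 + b) * (4 * w)) ≡ 4 * (t * (1 + b) * (w * w))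
                lem₂ = solve-∀

            Θ : ℕ → Set
            Θ r = θ * e ≤ r * w

            θx≤ : ∀ x y → q * x ≤ y + 2 * k * p * x → θ * x ≤ y
            θx≤ x y le =
              ≤-trans (≤-reflexive (*-distribʳ-∸ x q (2 * k * p)))
                (m≤n+o⇒m∸n≤o (q * x) (2 * k * p * x) (≤-trans le (≤-reflexive (+-comm y _))))

            -- The minimum degree is at least d, and 2`m` + `h` ≤ 8εd + k ≤ (8 + k)εd ≤ 2kεd,
            -- because εd ≥ 1 and k ≥ 8.
            degree : ∀ v r → deg G₀ v ≤ r + (2 * m + h) → Θ r
            degree v r le = θx≤ e (r * w) (begin
              q * e ≤⟨ *-monoʳ-≤ q (≤-trans (min-deg v) (*-monoˡ-≤ N le)) ⟩
              q * ((r + (2 * m + h)) * N) ≡⟨ lem q r m h N ⟩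
              r * w + (2 * (m * w) + h * w)
                ≤⟨ +-monoʳ-≤ (r * w) (+-mono-≤ (*-monoʳ-≤ 2 mw≤4u) (*-mono-≤ h≤k w≤u)) ⟩
              r * w + (2 * (4 * u) + k * u) ≡⟨ lem₂ (r * w) u k ⟩
              r * w + (8 + k) * u ≤⟨ +-monoʳ-≤ (r * w) (*-monoˡ-≤ u (+-monoˡ-≤ k (≤-trans (m≤m+n 8 8) 16≤k))) ⟩
              r * w + (k + k) * (p * e) ≡⟨ lem₃ (r * w) k p e ⟩
              r * w + 2 * k * p * e ∎)
              where
              lem : ∀ q r m h N → q * ((r + (2 * m + h)) * N) ≡ r * (q * N) + (2 * (m * (q * N)) + h * (q * N))
              lem = solve-∀
              lem₂ : ∀ x u k → x + (2 * (4 * u) + k * u) ≡ x + (8 + k) * u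
              lem₂ = solve-∀
              lem₃ : ∀ x k p e → x + (k + k) * (p * e) ≡ x + 2 * k * p * e
              lem₃ = solve-∀

            balanced : ∀ (X Y : V → Bool) → (∀ v → X v ≡ true → Y v ≡ false) →
                       (∀ x → X x ≡ true → Θ (countF (λ y → adj G₀ x y ∧ Y y))) → countF X ≤ ℓ * countF Y
            balanced X Y disj high = ≮⇒≥ (λ many → ¬P₂ X Y (disj′ , many , high))
              where
              disj′ : ∀ v → X v ∧ Y v ≡ false
              disj′ v with X v in Xv
              ... | true = disj v Xv
              ... | false = refl

            ContractedMinor : Set
            ContractedMinor =
              Σ Graph λ M → BoundedMinor k M G₀ × degsum (adj G₀) ≤ 4 * edges M + n G₀ *
                (h + m + 4 * (2 * (1 + b))) ×
              ∃ λ t → (1 + h) * n M ≤ n G₀ + (1 + h) * t × t * (1 + B) ≤ degsum (adj G₀)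

            contracted-minor : ContractedMinor
            contracted-minor =
              Contraction.dense-minor G₀ k ℓ h B b m Θ (λ le → λ t → ≤-trans t (*-monoˡ-≤ w le)) h>0 cap sparse
                balanced degree

            rescale : ContractedMinor → DenseMinor
            rescale (M , μ , many , t , roots , bigs) = M , minor-of-subgraph G₀⊆G μ , 0<L , final
              where
              e₀ = edges G₀
              n₀ = n G₀
              L = n M
              E = edges M
              κ = 2 * (1 + b)
              -- In terms of εd ≥ 1: `h` ≤ kεd, `m` ≤ 4εd and 4`κ` ≤ 8εd + 2kεd. The sum (12 + 3k)εd
              -- is at most 4kεd as k ≥ 12.
              cost : (h + m + 4 * κ) * w ≤ 4 * k * u
              cost = begin
                (h + m + 4 * κ) * w ≡⟨ lem h m b w ⟩
                h * w + m * w + (8 * w + 2 * (b * (4 * w)))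
                  ≤⟨ +-mono-≤ (+-mono-≤ (*-mono-≤ h≤k w≤u) mw≤4u)
                    (+-mono-≤ (*-monoʳ-≤ 8 w≤u) (*-monoʳ-≤ 2 (m/n*n≤m (k * u) (4 * w)))) ⟩
                k * u + 4 * u + (8 * u + 2 * (k * u)) ≡⟨ lem₂ k u ⟩
                (12 + 3 * k) * u ≤⟨ *-monoˡ-≤ u (+-monoˡ-≤ (3 * k) (≤-trans (m≤m+n 12 4) 16≤k)) ⟩
                4 * k * u ∎
                where
                lem : ∀ h m b w → (h + m + 4 * (2 * (1 + b))) * w ≡ h * w + m * w + (8 * w + 2 * (b * (4 * w)))
                lem = solve-∀
                lem₂ : ∀ k u → k * u + 4 * u + (8 * u + 2 * (k * u)) ≡ (12 + 3 * k) * u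
                lem₂ = solve-∀
              -- Since d`n₀` ≤ `e₀`, the total cost `n₀` · 4kεd is at most 4kε`e₀`. Hence 2`e₀` ≤
              -- 4`E` + 4kε`e₀`.
              edges-kept : θ * e₀ ≤ 2 * E * q
              edges-kept = θx≤ e₀ (2 * E * q) (*-cancelˡ-≤ 2 (*-cancelʳ-≤ _ _ N (begin
                2 * (q * e₀) * N ≡⟨ lem q e₀ N ⟩
                2 * e₀ * w ≤⟨ *-monoˡ-≤ w (≤-trans (≤-reflexive (2edges G₀)) many) ⟩
                (4 * E + n₀ * (h + m + 4 * κ)) * w ≡⟨ lem₂ E n₀ (h + m + 4 * κ) w ⟩
                4 * E * w + n₀ * ((h + m + 4 * κ) * w) ≤⟨ +-monoʳ-≤ (4 * E * w) (*-monoʳ-≤ n₀ cost) ⟩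
                4 * E * w + n₀ * (4 * k * u) ≡⟨ lem₃ (4 * E * w) n₀ k p e ⟩
                4 * E * w + 4 * k * p * (e * n₀) ≤⟨ +-monoʳ-≤ (4 * E * w) (*-monoʳ-≤ (4 * k * p) dense₀) ⟩
                4 * E * w + 4 * k * p * (e₀ * N) ≡⟨ lem₄ E q N k p e₀ ⟩
                2 * (2 * E * q + 2 * k * p * e₀) * N ∎)))
                where
                lem : ∀ q e₀ N → 2 * (q * e₀) * N ≡ 2 * e₀ * (q * N)
                lem = solve-∀
                lem₂ : ∀ E n₀ x w → (4 * E + n₀ * x) * w ≡ 4 * E * w + n₀ * (x * w)
                lem₂ = solve-∀
                lem₃ : ∀ x n₀ k p e → x + n₀ * (4 * k * (p * e)) ≡ x + 4 * k * p * (e * n₀)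
                lem₃ = solve-∀
                lem₄ : ∀ E q N k p e₀ → 4 * E * (q * N) + 4 * k * p * (e₀ * N) ≡ 2 *
                  (2 * E * q + 2 * k * p * e₀) * N
                lem₄ = solve-∀
              -- Ordinary classes contribute 2(ℓ+1)`e₀`, by k ≤ 2(ℓ+1)(1 + `h`) and d`n₀` ≤ `e₀`;
              -- big vertices contribute 2`e₀`, by kd ≤ 1 + `B`. The surplus 4 is absorbed by 2ℓ.
              few-vertices : k * e * L ≤ 4 * ℓ * e₀ * N
              few-vertices = *-cancelˡ-≤ (1 + h) (begin
                (1 + h) * (k * e * L) ≡⟨ lem (1 + h) k e L ⟩
                k * e * ((1 + h) * L) ≤⟨ *-monoʳ-≤ (k * e) roots ⟩
                k * e * (n₀ + (1 + h) * t) ≡⟨ lem₂ k e n₀ (1 + h) t ⟩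
                k * (e * n₀) + (1 + h) * (t * (k * e))
                  ≤⟨ +-mono-≤ (*-mono-≤ (≤[1+/] k ((1 + ℓ) * 2)) dense₀)
                    (*-monoʳ-≤ (1 + h) (≤-trans (*-monoʳ-≤ t (≤[1+/] (k * e) N))
                      (≤-trans (≤-reflexive (sym (*-assoc t (1 + B) N)))
                        (*-monoˡ-≤ N (≤-trans bigs (≤-reflexive (sym (2edges G₀)))))))) ⟩
                (1 + h) * ((1 + ℓ) * 2) * (e₀ * N) + (1 + h) * (2 * e₀ * N) ≡⟨ lem₃ (1 + h) ℓ e₀ N ⟩
                (1 + h) * ((2 * ℓ + 2 * 2) * e₀ * N)
                  ≤⟨ *-monoʳ-≤ (1 + h) (*-monoˡ-≤ N (*-monoˡ-≤ e₀ (+-monoʳ-≤ (2 * ℓ) (*-monoʳ-≤ 2 2≤ℓ)))) ⟩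
                (1 + h) * ((2 * ℓ + 2 * ℓ) * e₀ * N) ≡⟨ cong (λ z → (1 + h) * (z * e₀ * N)) (lem₄ ℓ) ⟩
                (1 + h) * (4 * ℓ * e₀ * N) ∎)
                where
                lem : ∀ h k e L → h * (k * e * L) ≡ k * e * (h * L)
                lem = solve-∀
                lem₂ : ∀ k e n₀ h t → k * e * (n₀ + h * t) ≡ k * (e * n₀) + h * (t * (k * e))
                lem₂ = solve-∀
                lem₃ : ∀ h ℓ e₀ N → h * ((1 + ℓ) * 2) * (e₀ * N) + h * (2 * e₀ * N) ≡ h *
                  ((2 * ℓ + 2 * 2) * e₀ * N)
                lem₃ = solve-∀
                lem₄ : ∀ ℓ → 2 * ℓ + 2 * ℓ ≡ 4 * ℓ
                lem₄ = solve-∀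
              final : k * θ * e * L ≤ E * (8 * ℓ * w)
              final = begin
                k * θ * e * L ≡⟨ lem k θ e L ⟩
                θ * (k * e * L) ≤⟨ *-monoʳ-≤ θ few-vertices ⟩
                θ * (4 * ℓ * e₀ * N) ≡⟨ lem₂ θ ℓ e₀ N ⟩
                4 * ℓ * N * (θ * e₀) ≤⟨ *-monoʳ-≤ (4 * ℓ * N) edges-kept ⟩
                4 * ℓ * N * (2 * E * q) ≡⟨ lem₃ ℓ N E q ⟩
                E * (8 * ℓ * w) ∎
                where
                lem : ∀ k θ e L → k * θ * e * L ≡ θ * (k * e * L)
                lem = solve-∀
                lem₂ : ∀ θ ℓ e₀ N → θ * (4 * ℓ * e₀ * N) ≡ 4 * ℓ * N * (θ * e₀)
                lem₂ = solve-∀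
                lem₃ : ∀ ℓ N E q → 4 * ℓ * N * (2 * E * q) ≡ E * (8 * ℓ * (q * N))
                lem₃ = solve-∀
              pos-left : ∀ {a b} → 0 < a * b → 0 < a
              pos-left {suc a} _ = z<s
              0<e : 0 < e
              0<e = pos-left {e} {p} (≤-trans 0<u (≤-reflexive (*-comm p e)))
              0<e₀ : 0 < e₀
              0<e₀ = pos-left {e₀} {N} (≤-trans (*-mono-≤ 0<e 0<n₀) dense₀)
              -- From ε < 1/(4k). Positivity of θ gives the minor an edge, and therefore a vertex,
              -- so that its density is defined.
              0<θ : 0 < θ
              0<θ = m<n⇒0<n∸m (≤-<-trans (*-monoˡ-≤ p (*-monoˡ-≤ k {2} {4} (s≤s (s≤s z≤n)))) 4kp<q)
              0<E : 0 < E
              0<E =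
                pos-left {E} {2 * q} (≤-trans (*-mono-≤ 0<θ 0<e₀) (≤-trans edges-kept (≤-reflexive (lem E q))))
                where
                lem : ∀ E q → 2 * E * q ≡ E * (2 * q)
                lem = solve-∀
              0<L : 0 < L
              0<L = edges-pos⇒n-pos M 0<E

            scaled-minor : DenseMinor
            scaled-minor = rescale contracted-minor

        nontrivial-case : DenseSpot ⊎ Unbalanced ⊎ DenseMinor
        nontrivial-case with anySubset? P₁?
        ... | yes (T , P) = inj₁ (P₁⇒DenseSpot (lookup T) P)
        ... | no ¬P₁ with anySubset? (λ X → anySubset? (P₂? X))
        ...   | yes (X , Y , P) = inj₂ (inj₁ (P₂⇒Unbalanced (lookup X) (lookup Y) P))
        ...   | no ¬P₂ = inj₂ (inj₂ (scaled-minor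
          (λ T P → ¬P₁ (tabulate T , P₁-cong (λ v → sym (lookup∘tabulate T v)) P))
          (λ X Y P → ¬P₂ (tabulate X , tabulate Y , P₂-cong (λ v → sym (lookup∘tabulate X v))
            (λ v → sym (lookup∘tabulate Y v)) P))))

      scaled-theorem : DenseSpot ⊎ Unbalanced ⊎ DenseMinor
      scaled-theorem with k ≤? 8 * ℓ
      ... | yes k≤8ℓ = inj₂ (inj₂ (trivial-case k≤8ℓ))
      ... | no k≰8ℓ with prune e N N G ≤-refl 0<N ≤-refl
      ...   | G₀ , G₀⊆G , dense₀ , 0<n₀ , min-deg = nontrivial-case (≰⇒> k≰8ℓ) G₀ G₀⊆G dense₀ 0<n₀ min-deg

module Fractions where

  open import Data.Integer as ℤ using (+_; +[1+_]; -[1+_])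
  import Data.Integer.Properties as ℤ
  import Data.Nat.Properties as ℕ
  open import Data.Rational hiding (NonZero)
  open import Data.Rational.Properties
  import Data.Rational.Unnormalised as ℚᵘ
  import Data.Rational.Unnormalised.Properties as ℚᵘ

  -- Fractions of natural numbers

  -- The fraction need not be in lowest terms, so numerators and denominators multiply freely and
  -- comparisons become cross-multiplications over ℕ.
  record Fraction (x : ℚ) (a b : ℕ) : Set where
    constructor fraction
    field
      {{denominator≢0}} : NonZero b
      value : x ≡ (+ a) / b

  toℚᵘ-/ : ∀ i b → toℚᵘ (i / suc b) ℚᵘ.≃ ℚᵘ.mkℚᵘ i b
  toℚᵘ-/ i b = toℚᵘ-fromℚᵘ (ℚᵘ.mkℚᵘ i b)

  Fraction-≤⁺ : ∀ {x y a b c d} → Fraction x a b → Fraction y c d → a ℕ.* d ℕ.≤ c ℕ.* b → x ≤ y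
  Fraction-≤⁺ {a = a} {suc b} {c} {suc d} (fraction refl) (fraction refl) le = toℚᵘ-cancel-≤
    (ℚᵘ.≤-respˡ-≃ (ℚᵘ.≃-sym (toℚᵘ-/ (+ a) b)) (ℚᵘ.≤-respʳ-≃ (ℚᵘ.≃-sym (toℚᵘ-/ (+ c) d))
      (ℚᵘ.*≤* (subst₂ ℤ._≤_ (ℤ.pos-* a (suc d)) (ℤ.pos-* c (suc b)) (ℤ.+≤+ le)))))

  Fraction-≤⁻ : ∀ {x y a b c d} → Fraction x a b → Fraction y c d → x ≤ y → a ℕ.* d ℕ.≤ c ℕ.* b
  Fraction-≤⁻ {a = a} {suc b} {c} {suc d} (fraction refl) (fraction refl) le
    with ℚᵘ.≤-respˡ-≃ (toℚᵘ-/ (+ a) b) (ℚᵘ.≤-respʳ-≃ (toℚᵘ-/ (+ c) d) (toℚᵘ-mono-≤ le))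
  ... | ℚᵘ.*≤* le′ = ℤ.drop‿+≤+ (subst₂ ℤ._≤_ (sym (ℤ.pos-* a (suc d))) (sym (ℤ.pos-* c (suc b))) le′)

  Fraction-<⁻ : ∀ {x y a b c d} → Fraction x a b → Fraction y c d → x < y → a ℕ.* d ℕ.< c ℕ.* b
  Fraction-<⁻ {a = a} {suc b} {c} {suc d} (fraction refl) (fraction refl) lt
    with ℚᵘ.<-respˡ-≃ (toℚᵘ-/ (+ a) b) (ℚᵘ.<-respʳ-≃ (toℚᵘ-/ (+ c) d) (toℚᵘ-mono-< lt))
  ... | ℚᵘ.*<* lt′ = ℤ.drop‿+<+ (subst₂ ℤ._<_ (sym (ℤ.pos-* a (suc d))) (sym (ℤ.pos-* c (suc b))) lt′)

  Fraction-* : ∀ {x y a b c d} → Fraction x a b → Fraction y c d → Fraction (x * y) (a ℕ.* c) (b ℕ.* d)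
  Fraction-* {a = a} {suc b} {c} {suc d} (fraction refl) (fraction refl) = fraction (toℚᵘ-injective (begin
    toℚᵘ (((+ a) / suc b) * ((+ c) / suc d)) ≈⟨ toℚᵘ-homo-* ((+ a) / suc b) ((+ c) / suc d) ⟩
    toℚᵘ ((+ a) / suc b) ℚᵘ.* toℚᵘ ((+ c) / suc d) ≈⟨ ℚᵘ.*-cong (toℚᵘ-/ (+ a) b) (toℚᵘ-/ (+ c) d) ⟩
    ℚᵘ.mkℚᵘ (+ a) b ℚᵘ.* ℚᵘ.mkℚᵘ (+ c) d ≈⟨ ℚᵘ.*≡* (cong (ℤ._* (+ (suc b ℕ.* suc d))) (sym (ℤ.pos-* a c))) ⟩
    ℚᵘ.mkℚᵘ (+ (a ℕ.* c)) (d ℕ.+ b ℕ.* suc d) ≈⟨ toℚᵘ-/ (+ (a ℕ.* c)) (d ℕ.+ b ℕ.* suc d) ⟨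
    toℚᵘ ((+ (a ℕ.* c)) / (suc b ℕ.* suc d)) ∎))
    where open ℚᵘ.≃-Reasoning

  -- The hypothesis makes the truncated subtraction exact.
  Fraction-1- : ∀ {x a b} → Fraction x a b → a ℕ.≤ b → Fraction (1ℚ - x) (b ℕ.∸ a) b
  Fraction-1- {x} {a} {suc b} (fraction refl) le = fraction (begin
    1ℚ - x ≡⟨ cong (_- x) (trans (sym whole) split) ⟩
    (rest + x) - x ≡⟨ +-assoc rest x (- x) ⟩
    rest + (x - x) ≡⟨ cong (_+_ rest) (+-inverseʳ x) ⟩
    rest + 0ℚ ≡⟨ +-identityʳ rest ⟩
    rest ∎)
    where
    open ≡-Reasoning
    rest = (+ (suc b ℕ.∸ a)) / suc b
    whole : (+ suc b) / suc b ≡ 1ℚ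
    whole = toℚᵘ-injective (ℚᵘ.≃-trans (toℚᵘ-/ (+ suc b) b) (ℚᵘ.*≡* (ℤ.*-comm (+ suc b) (+ 1))))
    split : (+ suc b) / suc b ≡ rest + x
    split = toℚᵘ-injective (ℚᵘ.≃-trans (toℚᵘ-/ (+ suc b) b) (ℚᵘ.≃-trans (ℚᵘ.*≡* eq)
      (ℚᵘ.≃-sym (ℚᵘ.≃-trans (toℚᵘ-homo-+ rest x) (ℚᵘ.+-cong (toℚᵘ-/ (+ (suc b ℕ.∸ a)) b) (toℚᵘ-/ (+ a) b))))))
      where
      eq : + suc b ℤ.* (+ suc b ℤ.* + suc b) ≡ (+ (suc b ℕ.∸ a) ℤ.* + suc b ℤ.+ + a ℤ.* + suc b) ℤ.* + suc b
      eq = trans (sym (ℤ.*-assoc (+ suc b) (+ suc b) (+ suc b))) (cong (ℤ._* + suc b)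
        (trans (cong (ℤ._* + suc b) (trans (cong +_ (sym (ℕ.m∸n+n≡m le))) (ℤ.pos-+ (suc b ℕ.∸ a) a)))
          (ℤ.*-distribʳ-+ (+ suc b) (+ (suc b ℕ.∸ a)) (+ a))))

  Fraction-⟦⟧ : ∀ a → Fraction ⟦ a ⟧ a 1
  Fraction-⟦⟧ a = fraction refl

  Fraction-recip : ∀ b .{{_ : NonZero b}} → Fraction (recip b) 1 b
  Fraction-recip (suc b) = fraction refl

  Fraction-density : ∀ G .{{nz : NonZero (n G)}} → Fraction (density G) (edges G) (n G)
  Fraction-density G {{nz}} = fraction {{ℕ.≢-nonZero (ℕ.≢-nonZero⁻¹ (n G))}} refl

  -- Once the numerator is matched as positive, `inv` computes and merely swaps numerator and
  -- denominator.
  positive-fraction : ∀ ε → (ε>0 : 0ℚ < ε) →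
    ∃ λ p → ∃ λ q → Fraction ε (suc p) (suc q) × Fraction (inv ε ε>0) (suc q) (suc p)
  positive-fraction ε@(mkℚ +[1+ p ] q _) ε>0 =
    p , q , fraction (sym (↥p/↧p≡p ε)) , fraction (sym (↥p/↧p≡p (inv ε ε>0)))
  positive-fraction (mkℚ (+ 0) q _) (*<* (ℤ.+<+ ()))
  positive-fraction (mkℚ (-[1+ p ]) q _) (*<* ())

-- Transfer from natural numbers to rationals.

open Combinatorics using (module Scaled)
open Fractions
import Data.Nat.Properties as ℕ
open import Data.Rational using (ℚ; 0ℚ; 1ℚ; _<_; _≤_; _*_; _-_; _/_; 1/_)

theorem4p4 : (k ℓ : ℕ) → 2 ℕ.≤ ℓ → ℓ ℕ.≤ k →
  (ε : ℚ) → (ε>0 : 0ℚ < ε) → ε < recip (4 ℕ.* k) →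
  (G : Graph) → .{{_ : NonZero (n G)}} →
  inv ε ε>0 ≤ density G →
  (Σ Graph λ H → SubgraphOf H G ×
      (⟦ n H ⟧ ≤ ⟦ 3 ℕ.* (k ℕ.* k ℕ.* k) ⟧ * density G) ×
      (ε * ε * density G * density G * recip 2 ≤ ⟦ edges H ⟧))
  ⊎ (Σ Graph λ H → SubgraphOf H G × Σ (Fin (n H) → Bool) λ inX →
      -- X = {v | inX v ≡ true}, Y = {v | inX v ≡ false}; H is bipartite with sides X, Y
      (∀ u v → adj H u v ≡ true → inX u ≡ true → inX v ≡ false) ×
      (ℓ ℕ.* countF (λ v → not (inX v)) ℕ.< countF inX) ×
      (∀ x → inX x ≡ true →
        (1ℚ - ⟦ 2 ℕ.* k ⟧ * ε) * density G
          ≤ ⟦ countF (λ y → adj H x y ∧ not (inX y)) ⟧))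
  ⊎ (Σ Graph λ G′ → BoundedMinor k G′ G × Σ (NonZero (n G′)) λ nz →
      ⟦ k ⟧ * recip (8 ℕ.* ℓ) * (1ℚ - ⟦ 2 ℕ.* k ⟧ * ε) * density G
        ≤ density G′ {{nz}})
theorem4p4 k ℓ 2≤ℓ ℓ≤k ε ε>0 ε<1/4k G 1/ε≤d = transfer (positive-fraction ε ε>0)
  where
  N = n G
  e = edges G
  fd : Fraction (density G) e N
  fd = Fraction-density G
  0<k : 0 ℕ.< k
  0<k = ℕ.≤-trans (ℕ.≤-trans (ℕ.s≤s ℕ.z≤n) 2≤ℓ) ℓ≤k
  4k≢0 : NonZero (4 ℕ.* k)
  4k≢0 = ℕ.>-nonZero (ℕ.≤-trans 0<k (ℕ.m≤m+n k _))
  8ℓ≢0 : NonZero (8 ℕ.* ℓ)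
  8ℓ≢0 = ℕ.>-nonZero (ℕ.≤-trans (ℕ.≤-trans (ℕ.s≤s ℕ.z≤n) 2≤ℓ) (ℕ.m≤m+n ℓ _))
  transfer : (∃ λ p → ∃ λ q → Fraction ε (suc p) (suc q) × Fraction (inv ε ε>0) (suc q) (suc p)) → _
  transfer (p′ , q′ , fε , f1/ε) =
    convert (Scaled.scaled-theorem k ℓ p q 2≤ℓ ℓ≤k 4kp<q G (ℕ.n≢0⇒n>0 (ℕ.≢-nonZero⁻¹ N)) w≤u)
    where
    open ℕ.≤-Reasoning
    p = suc p′
    q = suc q′
    4kp<q : 4 ℕ.* k ℕ.* p ℕ.< q
    4kp<q = begin-strict
      4 ℕ.* k ℕ.* p ≡⟨ ℕ.*-comm (4 ℕ.* k) p ⟩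
      p ℕ.* (4 ℕ.* k) <⟨ Fraction-<⁻ fε (Fraction-recip (4 ℕ.* k) {{4k≢0}}) ε<1/4k ⟩
      1 ℕ.* q ≡⟨ ℕ.*-identityˡ q ⟩
      q ∎
    -- This is 1/ε ≤ d multiplied out, that is, εd ≥ 1.
    w≤u : q ℕ.* N ℕ.≤ p ℕ.* e
    w≤u = ℕ.≤-trans (Fraction-≤⁻ f1/ε fd 1/ε≤d) (ℕ.≤-reflexive (ℕ.*-comm e p))
    open Scaled k ℓ p q 2≤ℓ ℓ≤k 4kp<q G (ℕ.n≢0⇒n>0 (ℕ.≢-nonZero⁻¹ N)) using
      (θ; DenseSpot; Unbalanced; DenseMinor)
    fθ : Fraction (1ℚ - ⟦ 2 ℕ.* k ⟧ * ε) (1 ℕ.* q ℕ.∸ 2 ℕ.* k ℕ.* p) (1 ℕ.* q)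
    fθ = Fraction-1- (Fraction-* (Fraction-⟦⟧ (2 ℕ.* k)) fε) (begin
      2 ℕ.* k ℕ.* p ≤⟨ ℕ.*-monoˡ-≤ p (ℕ.*-monoˡ-≤ k {2} {4} (ℕ.s≤s (ℕ.s≤s ℕ.z≤n))) ⟩
      4 ℕ.* k ℕ.* p ≤⟨ ℕ.<⇒≤ 4kp<q ⟩
      q ≡⟨ ℕ.*-identityˡ q ⟨
      1 ℕ.* q ∎)
    θ≡ : 1 ℕ.* q ℕ.∸ 2 ℕ.* k ℕ.* p ≡ θ
    θ≡ = cong (ℕ._∸ 2 ℕ.* k ℕ.* p) (ℕ.*-identityˡ q)
    convert : DenseSpot ⊎ Unbalanced ⊎ DenseMinor → _
    convert (inj₁ (H , s , few , many)) = inj₁ (H , s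
      , Fraction-≤⁺ (Fraction-⟦⟧ (n H)) (Fraction-* (Fraction-⟦⟧ (3 ℕ.* (k ℕ.* k ℕ.* k))) fd) (begin
          n H ℕ.* (1 ℕ.* N) ≡⟨ cong (n H ℕ.*_) (ℕ.*-identityˡ N) ⟩
          n H ℕ.* N ≤⟨ few ⟩
          3 ℕ.* (k ℕ.* k ℕ.* k) ℕ.* e ≡⟨ ℕ.*-identityʳ _ ⟨
          3 ℕ.* (k ℕ.* k ℕ.* k) ℕ.* e ℕ.* 1 ∎)
      , Fraction-≤⁺ (Fraction-* (Fraction-* (Fraction-* (Fraction-* fε fε) fd) fd) (Fraction-recip 2))
        (Fraction-⟦⟧ (edges H)) (begin
          p ℕ.* p ℕ.* e ℕ.* e ℕ.* 1 ℕ.* 1 ≡⟨ lem p e ⟩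
          p ℕ.* e ℕ.* (p ℕ.* e) ≤⟨ many ⟩
          2 ℕ.* edges H ℕ.* (q ℕ.* N ℕ.* (q ℕ.* N)) ≡⟨ lem₂ (edges H) q N ⟩
          edges H ℕ.* (q ℕ.* q ℕ.* N ℕ.* N ℕ.* 2) ∎))
      where
      lem : ∀ p e → p ℕ.* p ℕ.* e ℕ.* e ℕ.* 1 ℕ.* 1 ≡ p ℕ.* e ℕ.* (p ℕ.* e)
      lem = solve-∀
      lem₂ : ∀ E q N → 2 ℕ.* E ℕ.* (q ℕ.* N ℕ.* (q ℕ.* N)) ≡ E ℕ.* (q ℕ.* q ℕ.* N ℕ.* N ℕ.* 2)
      lem₂ = solve-∀
    convert (inj₂ (inj₁ (H , s , inX , bip , many , high))) = inj₂ (inj₁ (H , s , inX , bip , many , λ x Xx →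
      Fraction-≤⁺ (Fraction-* fθ fd) (Fraction-⟦⟧ (countF (λ y → adj H x y ∧ not (inX y)))) (begin
        (1 ℕ.* q ℕ.∸ 2 ℕ.* k ℕ.* p) ℕ.* e ℕ.* 1 ≡⟨ trans (ℕ.*-identityʳ _) (cong (ℕ._* e) θ≡) ⟩
        θ ℕ.* e ≤⟨ high x Xx ⟩
        countF (λ y → adj H x y ∧ not (inX y)) ℕ.* (q ℕ.* N)
          ≡⟨ cong (λ z → countF (λ y → adj H x y ∧ not (inX y)) ℕ.* (z ℕ.* N)) (ℕ.*-identityˡ q) ⟨
        countF (λ y → adj H x y ∧ not (inX y)) ℕ.* (1 ℕ.* q ℕ.* N) ∎)))
    convert (inj₂ (inj₂ (M , μ , 0<L , dense))) = inj₂ (inj₂ (M , μ , ℕ.>-nonZero 0<L ,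
      Fraction-≤⁺ (Fraction-* (Fraction-* (Fraction-* (Fraction-⟦⟧ k) (Fraction-recip (8 ℕ.* ℓ) {{8ℓ≢0}})) fθ)
        fd) (Fraction-density M {{ℕ.>-nonZero 0<L}}) (begin
        k ℕ.* 1 ℕ.* (1 ℕ.* q ℕ.∸ 2 ℕ.* k ℕ.* p) ℕ.* e ℕ.* n M
          ≡⟨ cong₂ (λ x y → x ℕ.* y ℕ.* e ℕ.* n M) (ℕ.*-identityʳ k) θ≡ ⟩
        k ℕ.* θ ℕ.* e ℕ.* n M ≤⟨ dense ⟩
        edges M ℕ.* (8 ℕ.* ℓ ℕ.* (q ℕ.* N)) ≡⟨ cong (edges M ℕ.*_) (lem ℓ q N) ⟩
        edges M ℕ.* (1 ℕ.* (8 ℕ.* ℓ) ℕ.* (1 ℕ.* q) ℕ.* N) ∎)))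
      where
      lem : ∀ ℓ q N → 8 ℕ.* ℓ ℕ.* (q ℕ.* N) ≡ 1 ℕ.* (8 ℕ.* ℓ) ℕ.* (1 ℕ.* q) ℕ.* N
      lem = solve-∀
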